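{- We have $$\sum_{n=0}^\infty\big(q^{n(n+1)}+q^{5n(n+1)+1}\big)=\frac{(q^3,q^7,q^{10};q^{10})_\infty\,(q^4,q^{16};q^{20})_\infty}{(q,q^4;q^5)_\infty}.$$
   Context: Here $q$ is a complex number with $|q|<1$ (equivalently, the identity may be read as an identity of formal power series in $q$). For a complex number $a$, $(a;q)_\infty:=\prod_{i=0}^\infty(1-aq^i)$, and $(a_1,a_2,\dots,a_m;q)_\infty:=\prod_{j=1}^m(a_j;q)_\infty$. -}

module Defs where

open import Data.Nat as ℕ using (ℕ; zero; suc; _∸_; _≡ᵇ_)
open import Data.Nat.Divisibility using (_∣?_)
open import Data.Integer using (ℤ; +_; -_; _+_; _*_)
open import Data.List using (List; map; foldr; upTo)
open import Data.Bool using (Bool; true; false; if_then_else_)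
open import Relation.Nullary.Decidable using (⌊_⌋)

-- A formal power series: its sequence of coefficients (coefficient of q^n).
PS : Set
PS = ℕ → ℤ

sumℤ : List ℤ → ℤ
sumℤ = foldr _+_ (+ 0)

infixl 7 _⊛_
_⊛_ : PS → PS → PS
(f ⊛ g) n = sumℤ (map (λ i → f i * g (n ∸ i)) (upTo (suc n)))

one : PS
one zero    = + 1
one (suc _) = + 0

-- The polynomial 1 - q^k  (used with k ≥ 1).
oneMinusQ : ℕ → PS
oneMinusQ k zero    = + 1
oneMinusQ k (suc n) = if k ≡ᵇ suc n then - (+ 1) else + 0

-- The series 1/(1 - q^k) = Σ_{j ≥ 0} q^{kj}  (used with k ≥ 1).
geomQ : ℕ → PS
geomQ k n = if ⌊ k ∣? n ⌋ then + 1 else + 0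

prodUpTo : ℕ → (ℕ → PS) → PS
prodUpTo zero    F = one
prodUpTo (suc n) F = prodUpTo n F ⊛ F n

-- (q^a ; q^m)_∞ = ∏_{i ≥ 0} (1 - q^{a + m i}), for a ≥ 1.
-- Its coefficient of q^N only depends on the factors with i ≤ N
-- (all later factors are ≡ 1 mod q^{N+1} since a + m i ≥ i + 1), so the
-- coefficient is read off from the finite product over i < N + 1.
qPoch : ℕ → ℕ → PS
qPoch a m N = prodUpTo (suc N) (λ i → oneMinusQ (a ℕ.+ m ℕ.* i)) N

-- 1 / (q^a ; q^m)_∞ = ∏_{i ≥ 0} 1/(1 - q^{a + m i}), for a ≥ 1 (same truncation).
qPochInv : ℕ → ℕ → PS
qPochInv a m N = prodUpTo (suc N) (λ i → geomQ (a ℕ.+ m ℕ.* i)) N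

δ : ℕ → ℕ → ℤ
δ x y = if x ≡ᵇ y then + 1 else + 0

-- The series Σ_{n ≥ 0} (q^{n(n+1)} + q^{5n(n+1)+1}).
-- Coefficient of q^N: only n ≤ N can contribute (both exponents are ≥ n).
lhsSeries : PS
lhsSeries N = sumℤ (map (λ n → δ (n ℕ.* suc n) N + δ (5 ℕ.* (n ℕ.* suc n) ℕ.+ 1) N)
                        (upTo (suc N)))

{-# OPTIONS --safe #-}

-- With f(x , y) = Σ_{k∈ℤ} x^{k(k+1)/2} y^{k(k−1)/2} and ψ(q) = Σ_{n≥0} q^{n(n+1)/2}, the left-hand side is
-- ψ(q²) + q ψ(q¹⁰).  Elementary product manipulations turn the claim into
--   f(q,q⁹) f(−q³,−q⁷) = W (q¹⁰;q¹⁰)_∞ (ψ(q²) + q ψ(q¹⁰)),   W = (q²,q⁶,q¹⁴,q¹⁸;q²⁰)_∞.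
-- Splitting the double sum on the left by the parity of m + n gives
--   f(−q⁴,−q¹⁶) f(−q⁸,−q¹²) + q f(−q⁶,−q¹⁴) f(−q²,−q¹⁸),
-- which the Jacobi triple product evaluates as (q⁴;q⁴)_∞ (q²⁰;q²⁰)_∞ + q W (q²⁰;q²⁰)_∞².  The right side is the
-- same because ψ(q²) (q²;q⁴)_∞ = (q⁴;q⁴)_∞ (again the triple product), and likewise with q⁵ in place of q.
-- The coefficient of q^N is computed in ℤ[[q]]/(q^M), M = N + 1: there q is nilpotent, so all sums and
-- products are finite, and the argument works in any commutative ring with an element q such that q^M = 0
-- and inverses of the 1 − q^k.
module Submission where

open import Defs
open import Level using (Level; 0ℓ)
open import Algebra.Bundles using (CommutativeRing)
open import Data.Bool using (true; false; if_then_else_)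
open import Data.Nat as ℕ using (ℕ; zero; suc)
import Data.Nat.Properties as ℕP
import Data.Nat.Tactic.RingSolver as ℕS
open import Data.Nat.Divisibility using (_∣?_; _∣_; ∣m+n∣m⇒∣n; ∣m∣n⇒∣m+n; ∣-refl; >⇒∤; _∣0)
open import Data.Integer as ℤ using (ℤ; +_; -[1+_]; ∣_∣)
import Data.Integer.Properties as ℤP
open import Data.Integer.Tactic.RingSolver using (solve-∀)
open import Data.List using ([]; _∷_; _∷ʳ_; upTo; applyUpTo; map)
open import Data.List.Properties using (map-upTo; applyUpTo-∷ʳ)
open import Data.Product using (_,_)
open import Function using (_∘_)
open import Relation.Binary.PropositionalEquality as ≡ using (_≡_)
open import Relation.Nullary using (yes; no; ¬_; contradiction)
open import Relation.Nullary.Decidable using (dec-false)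

-- Finite and bilateral sums

-- The parity split succeeds because both theta functions have quadratic part 5k²: with m = x - y
-- and n = x + y the cross terms of 5m² + 5n² cancel and leave 10x² + 10y², so each half factors
-- into two theta functions in base q²⁰. The obstacle is that a finite window -K ≤ k < K is
-- preserved neither by translations nor by this rotation of the lattice. A theta exponent is at
-- least |k|, so every theta term with |k| ≥ M vanishes; windows can then be enlarged at will, and a
-- change of variables only has to leave enough slack at the ends. The triple product is likewise
-- reached without a limit: Cauchy's finite identity is proved by induction on N and then read at N
-- = 2M, where all the q-factorials involved have become stationary. A sign σ with σ² = 1 lets one
-- proof cover both signs.

module Bilateral {c ℓ : Level} (R : CommutativeRing c ℓ) where
  open CommutativeRing R
  open import Algebra.Solver.Ring.NaturalCoefficients.Default commutativeSemiring using (solve; _:=_; _:+_; _:*_; con)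
  open import Relation.Binary.Reasoning.Setoid setoid

  Σ< : ℕ → (ℕ → Carrier) → Carrier
  Σ< zero    f = 0#
  Σ< (suc n) f = Σ< n f + f n

  Π< : ℕ → (ℕ → Carrier) → Carrier
  Π< zero    f = 1#
  Π< (suc n) f = Π< n f * f n

  Σ<-cong : ∀ n {f g} → (∀ i → f i ≈ g i) → Σ< n f ≈ Σ< n g
  Σ<-cong zero    p = refl
  Σ<-cong (suc n) p = +-cong (Σ<-cong n p) (p n)

  Σ<-+ : ∀ n f g → Σ< n (λ i → f i + g i) ≈ Σ< n f + Σ< n g
  Σ<-+ zero    f g = sym (+-identityˡ 0#)
  Σ<-+ (suc n) f g = trans (+-congʳ (Σ<-+ n f g))
    (solve 4 (λ a b x y → (a :+ b) :+ (x :+ y) := (a :+ x) :+ (b :+ y)) refl _ _ _ _)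

  Σ<-*ˡ : ∀ n x f → x * Σ< n f ≈ Σ< n (λ i → x * f i)
  Σ<-*ˡ zero    x f = zeroʳ x
  Σ<-*ˡ (suc n) x f = trans (distribˡ x _ _) (+-congʳ (Σ<-*ˡ n x f))

  Σ<-extend : ∀ {m n} f → m ℕ.≤ n → (∀ i → m ℕ.≤ i → f i ≈ 0#) → Σ< n f ≈ Σ< m f
  Σ<-extend {m} {zero}  f ℕ.z≤n p = refl
  Σ<-extend {m} {suc n} f m≤n p with m ℕ.≟ suc n
  ... | yes ≡.refl = refl
  ... | no  m≢n    =
    trans (+-cong (Σ<-extend f m≤ p) (p n m≤)) (+-identityʳ _)
    where m≤ = ℕP.≤-pred (ℕP.≤∧≢⇒< m≤n m≢n)

  Π<-cong : ∀ n {f g} → (∀ i → f i ≈ g i) → Π< n f ≈ Π< n g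
  Π<-cong zero    p = refl
  Π<-cong (suc n) p = *-cong (Π<-cong n p) (p n)

  Π<-* : ∀ n f g → Π< n (λ i → f i * g i) ≈ Π< n f * Π< n g
  Π<-* zero    f g = sym (*-identityˡ 1#)
  Π<-* (suc n) f g = trans (*-congʳ (Π<-* n f g))
    (solve 4 (λ a b x y → (a :* b) :* (x :* y) := (a :* x) :* (b :* y)) refl _ _ _ _)

  Π<-one : ∀ n f → (∀ i → f i ≈ 1#) → Π< n f ≈ 1#
  Π<-one zero    f p = refl
  Π<-one (suc n) f p = trans (*-cong (Π<-one n f p) (p n)) (*-identityˡ 1#)

  Π<-extend : ∀ {m n} f → m ℕ.≤ n → (∀ i → m ℕ.≤ i → f i ≈ 1#) → Π< n f ≈ Π< m f
  Π<-extend {m} {zero}  f ℕ.z≤n p = refl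
  Π<-extend {m} {suc n} f m≤n p with m ℕ.≟ suc n
  ... | yes ≡.refl = refl
  ... | no  m≢n    =
    trans (*-cong (Π<-extend f m≤ p) (p n m≤)) (*-identityʳ _)
    where m≤ = ℕP.≤-pred (ℕP.≤∧≢⇒< m≤n m≢n)

  Π<-split₂ : ∀ n f → Π< (n ℕ.* 2) f ≈
    Π< n (λ i → f (i ℕ.* 2)) * Π< n (λ i → f (1 ℕ.+ i ℕ.* 2))
  Π<-split₂ zero    f = sym (*-identityˡ 1#)
  Π<-split₂ (suc n) f = trans (*-congʳ (*-congʳ (Π<-split₂ n f)))
    (solve 4 (λ a b x y → a :* b :* x :* y := (a :* x) :* (b :* y)) refl _ _ _ _)

  Π<-split₅ : ∀ n f → Π< (n ℕ.* 5) f ≈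
    Π< n (λ i → f (i ℕ.* 5)) * Π< n (λ i → f (1 ℕ.+ i ℕ.* 5)) * Π< n (λ i → f (2 ℕ.+ i ℕ.* 5))
      * Π< n (λ i → f (3 ℕ.+ i ℕ.* 5)) * Π< n (λ i → f (4 ℕ.+ i ℕ.* 5))
  Π<-split₅ zero    f = solve 0 (con 1 := con 1 :* con 1 :* con 1 :* con 1 :* con 1) refl
  Π<-split₅ (suc n) f = trans (*-congʳ (*-congʳ (*-congʳ (*-congʳ (*-congʳ (Π<-split₅ n f))))))
    (solve 10 (λ a b c d e v w x y z → a :* b :* c :* d :* e :* v :* w :* x :* y :* z :=
       (a :* v) :* (b :* w) :* (c :* x) :* (d :* y) :* (e :* z)) refl _ _ _ _ _ _ _ _ _ _)

  -- The sum over the half-open range −K ≤ k < K.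
  Σℤ : ℕ → (ℤ → Carrier) → Carrier
  Σℤ zero    g = 0#
  Σℤ (suc K) g = Σℤ K g + (g (+ K) + g -[1+ K ])

  Σℤ-cong : ∀ K {g h} → (∀ k → ∣ k ∣ ℕ.≤ K → g k ≈ h k) → Σℤ K g ≈ Σℤ K h
  Σℤ-cong zero    p = refl
  Σℤ-cong (suc K) p = +-cong (Σℤ-cong K (λ k le → p k (ℕP.m≤n⇒m≤1+n le)))
    (+-cong (p (+ K) (ℕP.n≤1+n K)) (p -[1+ K ] ℕP.≤-refl))

  Σℤ-+ : ∀ K g h → Σℤ K (λ k → g k + h k) ≈ Σℤ K g + Σℤ K h
  Σℤ-+ zero    g h = sym (+-identityˡ 0#)
  Σℤ-+ (suc K) g h = trans (+-congʳ (Σℤ-+ K g h))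
    (solve 6 (λ a b u v x y → (a :+ b) :+ ((u :+ v) :+ (x :+ y)) :=
      (a :+ (u :+ x)) :+ (b :+ (v :+ y))) refl _ _ _ _ _ _)

  Σℤ-*ˡ : ∀ K x g → x * Σℤ K g ≈ Σℤ K (λ k → x * g k)
  Σℤ-*ˡ zero    x g = zeroʳ x
  Σℤ-*ˡ (suc K) x g = trans (distribˡ x _ _) (+-cong (Σℤ-*ˡ K x g) (distribˡ x _ _))

  Σℤ-* : ∀ K L g h → Σℤ K g * Σℤ L h ≈ Σℤ K (λ x → Σℤ L (λ y → g x * h y))
  Σℤ-* K L g h = begin
    Σℤ K g * Σℤ L h                       ≈⟨ *-comm _ _ ⟩
    Σℤ L h * Σℤ K g                       ≈⟨ Σℤ-*ˡ K _ g ⟩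
    Σℤ K (λ x → Σℤ L h * g x)             ≈⟨ Σℤ-cong K (λ x _ → trans (*-comm _ _) (Σℤ-*ˡ L (g x) h)) ⟩
    Σℤ K (λ x → Σℤ L (λ y → g x * h y))   ∎

  Σℤ-zero : ∀ K → Σℤ K (λ _ → 0#) ≈ 0#
  Σℤ-zero zero    = refl
  Σℤ-zero (suc K) = trans (+-cong (Σℤ-zero K) (+-identityˡ 0#)) (+-identityˡ 0#)

  Σℤ-swap : ∀ K L (g : ℤ → ℤ → Carrier) →
    Σℤ K (λ x → Σℤ L (λ y → g x y)) ≈ Σℤ L (λ y → Σℤ K (λ x → g x y))
  Σℤ-swap zero    L g = sym (Σℤ-zero L)
  Σℤ-swap (suc K) L g = begin
    Σℤ K (λ x → Σℤ L (g x)) + (Σℤ L (g (+ K)) + Σℤ L (g -[1+ K ]))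
      ≈⟨ +-cong (Σℤ-swap K L g) (sym (Σℤ-+ L _ _)) ⟩
    Σℤ L (λ y → Σℤ K (λ x → g x y)) + Σℤ L (λ y → g (+ K) y + g -[1+ K ] y)
      ≈⟨ Σℤ-+ L _ _ ⟨
    Σℤ L (λ y → Σℤ K (λ x → g x y) + (g (+ K) y + g -[1+ K ] y)) ∎

  -- The half-open window makes this exact: 2j and 2j + 1 with -K ≤ j < K fill -2K ≤ k < 2K with no
  -- boundary term.
  Σℤ-split₂ : ∀ K g → Σℤ (K ℕ.* 2) g ≈
    Σℤ K (λ k → g (k ℤ.* + 2)) + Σℤ K (λ k → g (k ℤ.* + 2 ℤ.+ + 1))
  Σℤ-split₂ zero    g = sym (+-identityˡ 0#)
  Σℤ-split₂ (suc K) g = trans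
    (+-cong (+-cong (Σℤ-split₂ K g)
      (+-congʳ (reflexive (≡.cong g (ℤP.pos-* K 2)))))
      (+-congʳ (reflexive (≡.cong g (≡.trans (≡.cong +_ (ℕP.+-comm 1 (K ℕ.* 2)))
         (≡.trans (ℤP.pos-+ (K ℕ.* 2) 1) (≡.cong (ℤ._+ + 1) (ℤP.pos-* K 2))))))))
    (solve 6 (λ a b u v x y → ((a :+ b) :+ (u :+ v)) :+ (x :+ y) :=
      (a :+ (u :+ y)) :+ (b :+ (x :+ v))) refl _ _ _ _ _ _)

  Vanishes : (ℤ → Carrier) → ℕ → Set ℓ
  Vanishes g B = ∀ k → B ℕ.≤ ∣ k ∣ → g k ≈ 0#

  Σℤ-extend : ∀ {B K} g → B ℕ.≤ K → Vanishes g B → Σℤ K g ≈ Σℤ B g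
  Σℤ-extend {B} {zero}  g ℕ.z≤n p = refl
  Σℤ-extend {B} {suc K} g B≤K p with B ℕ.≟ suc K
  ... | yes ≡.refl = refl
  ... | no  B≢K    =
    trans (+-cong (Σℤ-extend g B≤ p)
            (trans (+-cong (p (+ K) B≤) (p -[1+ K ] B≤K)) (+-identityˡ 0#)))
          (+-identityʳ _)
    where B≤ = ℕP.≤-pred (ℕP.≤∧≢⇒< B≤K B≢K)

  -- Translation by one loses the left end -K and gains the right end K. Each end is added on the
  -- side that lacks it, so no subtraction occurs.
  Σℤ-step : ∀ K g → Σℤ K (λ k → g (k ℤ.+ + 1)) + g (ℤ.- (+ K)) ≈ Σℤ K g + g (+ K)
  Σℤ-step zero    g = refl
  Σℤ-step (suc K) g = begin
    (Σℤ K (λ k → g (k ℤ.+ + 1)) + (g (+ K ℤ.+ + 1) + g (-[1+ K ] ℤ.+ + 1))) + g -[1+ K ]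
      ≈⟨ +-congʳ (+-congˡ (+-cong (reflexive (≡.cong (λ n → g (+ n)) (ℕP.+-comm K 1)))
                                  (reflexive (≡.cong g (1⊖1+n K))))) ⟩
    (Σℤ K (λ k → g (k ℤ.+ + 1)) + (g (+ suc K) + g (ℤ.- (+ K)))) + g -[1+ K ]
      ≈⟨ solve 4 (λ s a b c → (s :+ (a :+ b)) :+ c := (s :+ b) :+ (c :+ a)) refl _ _ _ _ ⟩
    (Σℤ K (λ k → g (k ℤ.+ + 1)) + g (ℤ.- (+ K))) + (g -[1+ K ] + g (+ suc K))
      ≈⟨ +-congʳ (Σℤ-step K g) ⟩
    (Σℤ K g + g (+ K)) + (g -[1+ K ] + g (+ suc K))
      ≈⟨ solve 4 (λ s a b c → (s :+ a) :+ (b :+ c) := (s :+ (a :+ b)) :+ c) refl _ _ _ _ ⟩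
    (Σℤ K g + (g (+ K) + g -[1+ K ])) + g (+ suc K) ∎
    where
    1⊖1+n : ∀ n → 1 ℤ.⊖ suc n ≡ ℤ.- (+ n)
    1⊖1+n zero    = ≡.refl
    1⊖1+n (suc n) = ≡.refl

  Σℤ-step-vanishing : ∀ K g → g (ℤ.- (+ K)) ≈ 0# → g (+ K) ≈ 0# →
    Σℤ K (λ k → g (k ℤ.+ + 1)) ≈ Σℤ K g
  Σℤ-step-vanishing K g p r = begin
    Σℤ K (λ k → g (k ℤ.+ + 1))                   ≈⟨ +-identityʳ _ ⟨
    Σℤ K (λ k → g (k ℤ.+ + 1)) + 0#              ≈⟨ +-congˡ p ⟨
    Σℤ K (λ k → g (k ℤ.+ + 1)) + g (ℤ.- (+ K))   ≈⟨ Σℤ-step K g ⟩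
    Σℤ K g + g (+ K)                             ≈⟨ +-congˡ r ⟩
    Σℤ K g + 0#                                  ≈⟨ +-identityʳ _ ⟩
    Σℤ K g                                       ∎

  ∣k∣≤∣k+c∣+∣c∣ : ∀ k c → ∣ k ∣ ℕ.≤ ∣ k ℤ.+ c ∣ ℕ.+ ∣ c ∣
  ∣k∣≤∣k+c∣+∣c∣ k c = ≡.subst (λ z → ∣ z ∣ ℕ.≤ ∣ k ℤ.+ c ∣ ℕ.+ ∣ c ∣) (cancel k c)
    (ℤP.∣i-j∣≤∣i∣+∣j∣ (k ℤ.+ c) c)
    where
    cancel : ∀ k c → (k ℤ.+ c) ℤ.- c ≡ k
    cancel = solve-∀

  Vanishes-shift : ∀ {g B} c → Vanishes g B → Vanishes (λ k → g (k ℤ.+ c)) (B ℕ.+ ∣ c ∣)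
  Vanishes-shift {g} {B} c p k le =
    p (k ℤ.+ c) (ℕP.+-cancelʳ-≤ ∣ c ∣ B _ (ℕP.≤-trans le (∣k∣≤∣k+c∣+∣c∣ k c)))

  -- The translation is made one unit at a time. The slack |c| guarantees that every intermediate
  -- summand vanishes at both ends ±K, where `Σℤ-step` would leave a boundary term.
  Σℤ-shift : ∀ {B K} g c → Vanishes g B → B ℕ.+ ∣ c ∣ ℕ.≤ K →
    Σℤ K (λ k → g (k ℤ.+ c)) ≈ Σℤ K g
  Σℤ-shift {B} {K} g (+ zero) p le =
    Σℤ-cong K (λ k _ → reflexive (≡.cong g (ℤP.+-identityʳ k)))
  Σℤ-shift {B} {K} g (+ suc n) p le = begin
    Σℤ K (λ k → g (k ℤ.+ + suc n))
      ≈⟨ Σℤ-cong K (λ k _ → reflexive (≡.cong g (≡.sym (ℤP.+-assoc k (+ 1) (+ n))))) ⟩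
    Σℤ K (λ k → g ((k ℤ.+ + 1) ℤ.+ + n))
      ≈⟨ Σℤ-step-vanishing K (λ k → g (k ℤ.+ + n)) (v (ℤ.- (+ K)) (ℕP.≤-reflexive (≡.sym (ℤP.∣-i∣≡∣i∣ (+ K)))))
           (v (+ K) ℕP.≤-refl) ⟩
    Σℤ K (λ k → g (k ℤ.+ + n))
      ≈⟨ Σℤ-shift g (+ n) p le′ ⟩
    Σℤ K g ∎
    where
    le′ : B ℕ.+ n ℕ.≤ K
    le′ = ℕP.≤-trans (ℕP.+-monoʳ-≤ B (ℕP.n≤1+n n)) le
    v : Vanishes (λ k → g (k ℤ.+ + n)) K
    v k K≤ = Vanishes-shift {g} {B} (+ n) p k (ℕP.≤-trans le′ K≤)
  Σℤ-shift {B} {K} g -[1+ n ] p le = begin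
    Σℤ K (λ k → g (k ℤ.+ -[1+ n ]))
      ≈⟨ Σℤ-step-vanishing K (λ k → g (k ℤ.+ -[1+ n ])) (v (ℤ.- (+ K)) (ℕP.≤-reflexive (≡.sym (ℤP.∣-i∣≡∣i∣ (+ K)))))
           (v (+ K) ℕP.≤-refl) ⟨
    Σℤ K (λ k → g ((k ℤ.+ + 1) ℤ.+ -[1+ n ]))
      ≈⟨ Σℤ-cong K (λ k _ → reflexive (≡.cong g (shift k n))) ⟩
    Σℤ K (λ k → g (k ℤ.+ ℤ.- (+ n)))
      ≈⟨ Σℤ-shift′ n le′ ⟩
    Σℤ K g ∎
    where
    le′ : B ℕ.+ n ℕ.≤ K
    le′ = ℕP.≤-trans (ℕP.+-monoʳ-≤ B (ℕP.n≤1+n n)) le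
    v : Vanishes (λ k → g (k ℤ.+ -[1+ n ])) K
    v k K≤ = Vanishes-shift {g} {B} -[1+ n ] p k (ℕP.≤-trans le K≤)
    shift : ∀ k n → (k ℤ.+ + 1) ℤ.+ -[1+ n ] ≡ k ℤ.+ ℤ.- (+ n)
    shift k zero    = ≡.trans (ℤP.+-assoc k (+ 1) -[1+ 0 ]) ≡.refl
    shift k (suc n) = ≡.trans (ℤP.+-assoc k (+ 1) -[1+ suc n ]) ≡.refl
    -- Splitting `m` puts -m into constructor form, so that the descent can continue.
    Σℤ-shift′ : ∀ m → B ℕ.+ m ℕ.≤ K → Σℤ K (λ k → g (k ℤ.+ ℤ.- (+ m))) ≈ Σℤ K g
    Σℤ-shift′ zero    le″ = Σℤ-cong K (λ k _ → reflexive (≡.cong g (ℤP.+-identityʳ k)))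
    Σℤ-shift′ (suc m) le″ = Σℤ-shift g -[1+ m ] p le″

  -- The lattice change of variables (m , n) = (x − y , x + y) or (x − y − 1 , x + y),
  -- according to the parity of m + n.
  Σℤ-rotate : ∀ B (g : ℤ → ℤ → Carrier) → (∀ n → Vanishes (λ m → g m n) B) → (∀ m → Vanishes (g m) B) →
    let K = B ℕ.+ (B ℕ.* 2 ℕ.+ 1 ℕ.+ 1) ; L = B ℕ.* 2 ℕ.+ 1 in
    Σℤ K (λ m → Σℤ (L ℕ.* 2) (g m)) ≈
      Σℤ L (λ y → Σℤ K (λ x → g (x ℤ.- y) (x ℤ.+ y))) +
      Σℤ L (λ y → Σℤ K (λ x → g (x ℤ.- y ℤ.- + 1) (x ℤ.+ y)))
  Σℤ-rotate B g vanˡ vanʳ = begin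
    Σℤ K (λ m → Σℤ (L ℕ.* 2) (g m))
      -- Writing n = m + j makes m + n = 2m + j, so the parity of m + n is that of the new inner
      -- index j, which is then split as 2y or 2y + 1.
      ≈⟨ Σℤ-cong K (λ m m≤K → trans (sym (Σℤ-shift (g m) m (vanʳ m) (bound m m≤K))) (Σℤ-split₂ L _)) ⟩
    Σℤ K (λ m → Σℤ L (λ y → g m (y ℤ.* + 2 ℤ.+ m)) + Σℤ L (λ y → g m (y ℤ.* + 2 ℤ.+ + 1 ℤ.+ m)))
      ≈⟨ Σℤ-+ K _ _ ⟩
    Σℤ K (λ m → Σℤ L (λ y → g m (y ℤ.* + 2 ℤ.+ m))) + Σℤ K (λ m → Σℤ L (λ y → g m (y ℤ.* + 2 ℤ.+ + 1 ℤ.+ m)))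
      ≈⟨ +-cong (Σℤ-swap K L _) (Σℤ-swap K L _) ⟩
    Σℤ L (λ y → Σℤ K (λ m → g m (y ℤ.* + 2 ℤ.+ m))) + Σℤ L (λ y → Σℤ K (λ m → g m (y ℤ.* + 2 ℤ.+ + 1 ℤ.+ m)))
      ≈⟨ +-cong
           (Σℤ-cong L (λ y y≤L → trans
             (sym (Σℤ-shift (λ m → g m (y ℤ.* + 2 ℤ.+ m)) (ℤ.- y) (λ m → vanˡ _ m) (even-bound y y≤L)))
             (Σℤ-cong K (λ x _ → reflexive (≡.cong (g (x ℤ.- y)) (even x y))))))
           (Σℤ-cong L (λ y y≤L → trans
             (sym (Σℤ-shift (λ m → g m (y ℤ.* + 2 ℤ.+ + 1 ℤ.+ m)) (ℤ.- y ℤ.- + 1) (λ m → vanˡ _ m) (odd-bound y y≤L)))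
             (Σℤ-cong K (λ x _ → reflexive (≡.cong₂ g (≡.sym (ℤP.+-assoc x (ℤ.- y) -[1+ 0 ])) (odd x y)))))) ⟩
    Σℤ L (λ y → Σℤ K (λ x → g (x ℤ.- y) (x ℤ.+ y))) + Σℤ L (λ y → Σℤ K (λ x → g (x ℤ.- y ℤ.- + 1) (x ℤ.+ y))) ∎
    where
    -- The outer shifts by -y and -y - 1 with |y| ≤ L need B + L + 1 ≤ K, and the inner shift by m
    -- with |m| ≤ K needs B + K ≤ 2L. The least solution is L = 2B + 1, K = B + L + 1, with equality
    -- in both.
    K = B ℕ.+ (B ℕ.* 2 ℕ.+ 1 ℕ.+ 1)
    L = B ℕ.* 2 ℕ.+ 1
    even : ∀ x y → y ℤ.* + 2 ℤ.+ (x ℤ.- y) ≡ x ℤ.+ y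
    even = solve-∀
    odd : ∀ x y → y ℤ.* + 2 ℤ.+ + 1 ℤ.+ (x ℤ.+ (ℤ.- y ℤ.- + 1)) ≡ x ℤ.+ y
    odd = solve-∀
    bound : ∀ m → ∣ m ∣ ℕ.≤ K → B ℕ.+ ∣ m ∣ ℕ.≤ L ℕ.* 2
    bound m le = ℕP.≤-trans (ℕP.+-monoʳ-≤ B le) (ℕP.≤-reflexive (double B))
      where
      double : ∀ B → B ℕ.+ (B ℕ.+ (B ℕ.* 2 ℕ.+ 1 ℕ.+ 1)) ≡ (B ℕ.* 2 ℕ.+ 1) ℕ.* 2
      double = ℕS.solve-∀
    even-bound : ∀ y → ∣ y ∣ ℕ.≤ L → B ℕ.+ ∣ ℤ.- y ∣ ℕ.≤ K
    even-bound y le = ℕP.+-monoʳ-≤ B (ℕP.≤-trans (≡.subst (ℕ._≤ L) (≡.sym (ℤP.∣-i∣≡∣i∣ y)) le) (ℕP.m≤m+n L 1))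
    odd-bound : ∀ y → ∣ y ∣ ℕ.≤ L → B ℕ.+ ∣ ℤ.- y ℤ.- + 1 ∣ ℕ.≤ K
    odd-bound y le = ℕP.+-monoʳ-≤ B (ℕP.≤-trans (ℤP.∣i-j∣≤∣i∣+∣j∣ (ℤ.- y) (+ 1))
      (ℕP.+-monoˡ-≤ 1 (≡.subst (ℕ._≤ L) (≡.sym (ℤP.∣-i∣≡∣i∣ y)) le)))

-- The Jacobi triple product and theta functions at a nilpotent q

module SignPower {c ℓ : Level} (R : CommutativeRing c ℓ) (σ : CommutativeRing.Carrier R)
  (σσ≈1 : CommutativeRing._≈_ R (CommutativeRing._*_ R σ σ) (CommutativeRing.1# R)) where
  open CommutativeRing R
  open import Algebra.Properties.Semiring.Exp semiring using (_^_; ^-congʳ)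
  open import Relation.Binary.Reasoning.Setoid setoid

  -- As σ² = 1, only the parity of the exponent matters, so |k| can stand for k and the result is
  -- still multiplicative on ℤ.
  sgn : ℤ → Carrier
  sgn k = σ ^ ∣ k ∣

  σσx≈x : ∀ x → σ * (σ * x) ≈ x
  σσx≈x x = trans (sym (*-assoc σ σ x)) (trans (*-congʳ σσ≈1) (*-identityˡ x))

  sgn-suc : ∀ k → sgn (k ℤ.+ + 1) ≈ σ * sgn k
  sgn-suc (+ n)        = ^-congʳ σ (ℕP.+-comm n 1)
  sgn-suc -[1+ zero ]  = sym (σσx≈x 1#)
  sgn-suc -[1+ suc n ] = sym (σσx≈x _)

  sgn-pred : ∀ k → sgn (k ℤ.+ -[1+ 0 ]) ≈ σ * sgn k
  sgn-pred k = begin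
    sgn (k ℤ.+ -[1+ 0 ])                      ≈⟨ σσx≈x _ ⟨
    σ * (σ * sgn (k ℤ.+ -[1+ 0 ]))            ≈⟨ *-congˡ (sgn-suc (k ℤ.+ -[1+ 0 ])) ⟨
    σ * sgn ((k ℤ.+ -[1+ 0 ]) ℤ.+ + 1)        ≈⟨ *-congˡ (reflexive (≡.cong sgn (cancel k))) ⟩
    σ * sgn k                                 ∎
    where
    cancel : ∀ k → (k ℤ.+ -[1+ 0 ]) ℤ.+ + 1 ≡ k
    cancel = solve-∀

  sgn-+ : ∀ x y → sgn (x ℤ.+ y) ≈ sgn x * sgn y
  sgn-+ (+ zero)  y = trans (reflexive (≡.cong sgn (ℤP.+-identityˡ y))) (sym (*-identityˡ _))
  sgn-+ (+ suc n) y = begin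
    sgn ((+ 1 ℤ.+ + n) ℤ.+ y)   ≈⟨ reflexive (≡.cong sgn (move (+ n) y)) ⟩
    sgn ((+ n ℤ.+ y) ℤ.+ + 1)   ≈⟨ sgn-suc (+ n ℤ.+ y) ⟩
    σ * sgn (+ n ℤ.+ y)         ≈⟨ *-congˡ (sgn-+ (+ n) y) ⟩
    σ * (sgn (+ n) * sgn y)     ≈⟨ *-assoc _ _ _ ⟨
    σ * sgn (+ n) * sgn y       ∎
    where
    move : ∀ x y → (+ 1 ℤ.+ x) ℤ.+ y ≡ (x ℤ.+ y) ℤ.+ + 1
    move = solve-∀
  sgn-+ -[1+ zero ] y = begin
    sgn (-[1+ 0 ] ℤ.+ y)   ≈⟨ reflexive (≡.cong sgn (ℤP.+-comm -[1+ 0 ] y)) ⟩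
    sgn (y ℤ.+ -[1+ 0 ])   ≈⟨ sgn-pred y ⟩
    σ * sgn y              ≈⟨ *-congʳ (sym (*-identityʳ σ)) ⟩
    σ * 1# * sgn y         ∎
  sgn-+ -[1+ suc n ] y = begin
    sgn ((-[1+ 0 ] ℤ.+ -[1+ n ]) ℤ.+ y)   ≈⟨ reflexive (≡.cong sgn (move -[1+ n ] y)) ⟩
    sgn ((-[1+ n ] ℤ.+ y) ℤ.+ -[1+ 0 ])   ≈⟨ sgn-pred (-[1+ n ] ℤ.+ y) ⟩
    σ * sgn (-[1+ n ] ℤ.+ y)              ≈⟨ *-congˡ (sgn-+ -[1+ n ] y) ⟩
    σ * (sgn -[1+ n ] * sgn y)            ≈⟨ *-assoc _ _ _ ⟨
    σ * sgn -[1+ n ] * sgn y              ∎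
    where
    move : ∀ x y → (-[1+ 0 ] ℤ.+ x) ℤ.+ y ≡ (x ℤ.+ y) ℤ.+ -[1+ 0 ]
    move = solve-∀

-- Exponents of the theta series

-- The exponent h k² + (a − h) k, written without subtraction under a + b = 2h.
thetaExp : (h a b : ℕ) → ℤ → ℕ
thetaExp h a b (+ zero)  = 0
thetaExp h a b (+ suc n) = suc n ℕ.* (h ℕ.* n ℕ.+ a)
thetaExp h a b -[1+ n ]  = suc n ℕ.* (h ℕ.* n ℕ.+ b)

pos-suc-*-linear : ∀ n h a → + (suc n ℕ.* (h ℕ.* n ℕ.+ a)) ≡ (+ 1 ℤ.+ + n) ℤ.* (+ h ℤ.* + n ℤ.+ + a)
pos-suc-*-linear n h a = ≡.trans (ℤP.pos-* (suc n) (h ℕ.* n ℕ.+ a))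
  (≡.cong (+ suc n ℤ.*_) (≡.trans (ℤP.pos-+ (h ℕ.* n) a) (≡.cong (ℤ._+ + a) (ℤP.pos-* h n))))

thetaExp-spec : ∀ h a b → a ℕ.+ b ≡ h ℕ.+ h → ∀ k →
  + thetaExp h a b k ≡ + h ℤ.* k ℤ.* k ℤ.+ (+ a ℤ.- + h) ℤ.* k
thetaExp-spec h a b eq (+ zero) = zero-case (+ h) (+ a ℤ.- + h)
  where
  zero-case : ∀ h c → + 0 ≡ h ℤ.* + 0 ℤ.* + 0 ℤ.+ c ℤ.* + 0
  zero-case = solve-∀
thetaExp-spec h a b eq (+ suc n) = ≡.trans (pos-suc-*-linear n h a) (pos-case (+ h) (+ a) (+ n))
  where
  pos-case : ∀ h a n → (+ 1 ℤ.+ n) ℤ.* (h ℤ.* n ℤ.+ a) ≡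
    h ℤ.* (+ 1 ℤ.+ n) ℤ.* (+ 1 ℤ.+ n) ℤ.+ (a ℤ.- h) ℤ.* (+ 1 ℤ.+ n)
  pos-case = solve-∀
thetaExp-spec h a b eq -[1+ n ] = ≡.trans (pos-suc-*-linear n h b)
  (≡.trans (≡.cong (λ z → (+ 1 ℤ.+ + n) ℤ.* (+ h ℤ.* + n ℤ.+ z)) b≡2h-a) (neg-case (+ h) (+ a) (+ n)))
  where
  cancel : ∀ a b → b ≡ (a ℤ.+ b) ℤ.- a
  cancel = solve-∀
  b≡2h-a : + b ≡ (+ h ℤ.+ + h) ℤ.- + a
  b≡2h-a = ≡.trans (cancel (+ a) (+ b)) (≡.cong (λ z → + z ℤ.- + a) eq)
  neg-case : ∀ h a n → (+ 1 ℤ.+ n) ℤ.* (h ℤ.* n ℤ.+ ((h ℤ.+ h) ℤ.- a)) ≡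
    h ℤ.* (ℤ.- (+ 1 ℤ.+ n)) ℤ.* (ℤ.- (+ 1 ℤ.+ n)) ℤ.+ (a ℤ.- h) ℤ.* (ℤ.- (+ 1 ℤ.+ n))
  neg-case = solve-∀

-- Source of all vanishing of theta terms: once |k| ≥ M, the power of q is at least the M-th.
∣k∣≤thetaExp : ∀ h a b .{{_ : ℕ.NonZero a}} .{{_ : ℕ.NonZero b}} k → ∣ k ∣ ℕ.≤ thetaExp h a b k
∣k∣≤thetaExp h a       b       (+ zero)  = ℕ.z≤n
∣k∣≤thetaExp h (suc a) b       (+ suc n) rewrite ℕP.+-suc (h ℕ.* n) a = ℕP.m≤m*n (suc n) (suc (h ℕ.* n ℕ.+ a))
∣k∣≤thetaExp h a       (suc b) -[1+ n ]  rewrite ℕP.+-suc (h ℕ.* n) b = ℕP.m≤m*n (suc n) (suc (h ℕ.* n ℕ.+ b))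

-- With Q = q^(2h): multiplying the k-th theta term by q^a Q^N yields the term at k + 1 times
-- Q^(N-k). This is how a new factor of the product acts on the sum.
thetaExp-suc : ∀ h a b → a ℕ.+ b ≡ h ℕ.+ h → ∀ N k j → + N ℤ.- k ≡ + j →
  thetaExp h a b k ℕ.+ (a ℕ.+ (h ℕ.+ h) ℕ.* N) ≡ thetaExp h a b (k ℤ.+ + 1) ℕ.+ (h ℕ.+ h) ℕ.* j
thetaExp-suc h a b eq N k j N-k≡j = ℤP.+-injective (begin
  + e k ℤ.+ (+ a ℤ.+ + ((h ℕ.+ h) ℕ.* N))
    ≡⟨ ≡.cong₂ (λ x y → x ℤ.+ (+ a ℤ.+ y)) (thetaExp-spec h a b eq k) (ℤP.pos-* (h ℕ.+ h) N) ⟩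
  (+ h ℤ.* k ℤ.* k ℤ.+ (+ a ℤ.- + h) ℤ.* k) ℤ.+ (+ a ℤ.+ (+ h ℤ.+ + h) ℤ.* + N)
    ≡⟨ identity (+ h) (+ a) k (+ N) ⟩
  (+ h ℤ.* (k ℤ.+ + 1) ℤ.* (k ℤ.+ + 1) ℤ.+ (+ a ℤ.- + h) ℤ.* (k ℤ.+ + 1)) ℤ.+ (+ h ℤ.+ + h) ℤ.* (+ N ℤ.- k)
    ≡⟨ ≡.cong₂ ℤ._+_ (≡.sym (thetaExp-spec h a b eq (k ℤ.+ + 1)))
         (≡.trans (≡.cong ((+ h ℤ.+ + h) ℤ.*_) N-k≡j) (≡.sym (ℤP.pos-* (h ℕ.+ h) j))) ⟩
  + e (k ℤ.+ + 1) ℤ.+ + ((h ℕ.+ h) ℕ.* j) ∎)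
  where
  open ≡.≡-Reasoning
  e = thetaExp h a b
  identity : ∀ h a k N → (h ℤ.* k ℤ.* k ℤ.+ (a ℤ.- h) ℤ.* k) ℤ.+ (a ℤ.+ (h ℤ.+ h) ℤ.* N) ≡
    (h ℤ.* (k ℤ.+ + 1) ℤ.* (k ℤ.+ + 1) ℤ.+ (a ℤ.- h) ℤ.* (k ℤ.+ + 1)) ℤ.+ (h ℤ.+ h) ℤ.* (N ℤ.- k)
  identity = solve-∀

thetaExp-neg : ∀ h a b k → thetaExp h a b (ℤ.- k) ≡ thetaExp h b a k
thetaExp-neg h a b (+ zero)  = ≡.refl
thetaExp-neg h a b (+ suc n) = ≡.refl
thetaExp-neg h a b -[1+ n ]  = ≡.refl

-- The reflection k ↦ -k exchanges `a` and `b`, which reduces this to `thetaExp-suc`.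
thetaExp-pred : ∀ h a b → a ℕ.+ b ≡ h ℕ.+ h → ∀ N k j → + N ℤ.+ k ≡ + j →
  thetaExp h a b k ℕ.+ (b ℕ.+ (h ℕ.+ h) ℕ.* N) ≡ thetaExp h a b (k ℤ.+ -[1+ 0 ]) ℕ.+ (h ℕ.+ h) ℕ.* j
thetaExp-pred h a b eq N k j N+k≡j = begin
  thetaExp h a b k ℕ.+ x              ≡⟨ ≡.cong (ℕ._+ x) (thetaExp-neg h b a k) ⟨
  thetaExp h b a (ℤ.- k) ℕ.+ x
    ≡⟨ thetaExp-suc h b a (≡.trans (ℕP.+-comm b a) eq) N (ℤ.- k) j
         (≡.trans (≡.cong (ℤ._+_ (+ N)) (ℤP.neg-involutive k)) N+k≡j) ⟩
  thetaExp h b a (ℤ.- k ℤ.+ + 1) ℕ.+ y ≡⟨ ≡.cong (λ z → thetaExp h b a z ℕ.+ y) (ℤP.neg-distrib-+ k -[1+ 0 ]) ⟨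
  thetaExp h b a (ℤ.- (k ℤ.+ -[1+ 0 ])) ℕ.+ y ≡⟨ ≡.cong (ℕ._+ y) (thetaExp-neg h b a (k ℤ.+ -[1+ 0 ])) ⟩
  thetaExp h a b (k ℤ.+ -[1+ 0 ]) ℕ.+ y ∎
  where
  open ≡.≡-Reasoning
  x = b ℕ.+ (h ℕ.+ h) ℕ.* N
  y = (h ℕ.+ h) ℕ.* j

module Nilpotent {c ℓ : Level} (R : CommutativeRing c ℓ) (q : CommutativeRing.Carrier R) (M : ℕ) where
  open CommutativeRing R
  open import Algebra.Properties.Semiring.Exp semiring using (_^_; ^-congʳ; ^-homo-*)
  open import Algebra.Solver.Ring.NaturalCoefficients.Default commutativeSemiring using (solve; _:=_; _:+_; _:*_; con)
  open import Algebra.Properties.Ring ring using (-1*x≈-x)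
  open import Algebra.Properties.Group +-group using (∙-cancelʳ; ⁻¹-involutive)
  open import Relation.Binary.Reasoning.Setoid setoid
  open Bilateral R

  -- (−σ q^a ; q^m)_n
  poch : ℕ → Carrier → ℕ → ℕ → Carrier
  poch n σ a m = Π< n (λ i → 1# + σ * q ^ (a ℕ.+ m ℕ.* i))

  1-x≈1+[-1]x : ∀ x → 1# + - x ≈ 1# + - 1# * x
  1-x≈1+[-1]x x = +-congˡ (sym (-1*x≈-x x))

  [1-x]y≈y-xy : ∀ x y → (1# + - 1# * x) * y ≈ y + - (x * y)
  [1-x]y≈y-xy x y = begin
    (1# + - 1# * x) * y         ≈⟨ distribʳ y 1# (- 1# * x) ⟩
    1# * y + - 1# * x * y       ≈⟨ +-cong (*-identityˡ y) (*-assoc (- 1#) x y) ⟩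
    y + - 1# * (x * y)          ≈⟨ +-congˡ (-1*x≈-x (x * y)) ⟩
    y + - (x * y)               ∎

  -- With the inverses of the 1 - q^k as a parameter, `geomQ` itself can be supplied later, so that
  -- `O⁻¹` is built from the very factors of `qPochInv`.
  module Laws
    (q^M≈0 : q ^ M ≈ 0#) (geo : ℕ → Carrier)
    (geo-inverse : ∀ k → (1# + - 1# * q ^ suc k) * geo (suc k) ≈ 1#) where

    q^-zero : ∀ {k} → M ℕ.≤ k → q ^ k ≈ 0#
    q^-zero {k} M≤k = begin
      q ^ k                      ≈⟨ ^-congʳ q (≡.sym (ℕP.m+[n∸m]≡n M≤k)) ⟩
      q ^ (M ℕ.+ (k ℕ.∸ M))      ≈⟨ ^-homo-* q M _ ⟩
      q ^ M * q ^ (k ℕ.∸ M)      ≈⟨ *-congʳ q^M≈0 ⟩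
      0# * q ^ (k ℕ.∸ M)         ≈⟨ zeroˡ _ ⟩
      0#                         ∎

    1-x+x≈1 : ∀ x → (1# + - 1# * x) + x ≈ 1#
    1-x+x≈1 x = begin
      (1# + - 1# * x) + x   ≈⟨ +-assoc _ _ _ ⟩
      1# + (- 1# * x + x)   ≈⟨ +-congˡ (+-congʳ (-1*x≈-x x)) ⟩
      1# + (- x + x)        ≈⟨ +-congˡ (-‿inverseˡ x) ⟩
      1# + 0#               ≈⟨ +-identityʳ 1# ⟩
      1#                    ∎

    poch-extend : ∀ {n} σ a m .{{_ : ℕ.NonZero m}} → M ℕ.≤ n → poch n σ a m ≈ poch M σ a m
    poch-extend σ a m M≤n = Π<-extend _ M≤n λ i M≤i →
      trans (+-congˡ (trans (*-congˡ (q^-zero (ℕP.≤-trans M≤i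
              (ℕP.≤-trans (ℕP.m≤n*m i m) (ℕP.m≤n+m (m ℕ.* i) a))))) (zeroʳ σ)))
            (+-identityʳ 1#)

    -- The Jacobi triple product through Cauchy's finite form

    module JacobiTriple (σ : Carrier) (σσ≈1 : σ * σ ≈ 1#) (h a b : ℕ)
      (a+b≡h+h : a ℕ.+ b ≡ h ℕ.+ h) {{a≢0 : ℕ.NonZero a}} {{b≢0 : ℕ.NonZero b}} where
      open SignPower R σ σσ≈1 public

      m : ℕ
      m = h ℕ.+ h

      instance
        m≢0 : ℕ.NonZero m
        m≢0 = ≡.subst ℕ.NonZero a+b≡h+h (ℕ.>-nonZero (ℕP.<-≤-trans (ℕ.>-nonZero⁻¹ a) (ℕP.m≤m+n a b)))

      e : ℤ → ℕ
      e = thetaExp h a b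

      term : ℤ → Carrier
      term k = sgn k * q ^ e k

      d : ℕ → Carrier
      d n = 1# + - 1# * q ^ (m ℕ.* n)

      -- With Q = q^m these are (Q;Q)_n and its inverse.
      P V : ℕ → Carrier
      P n = Π< n (λ i → d (suc i))
      V n = Π< n (λ i → geo (m ℕ.* suc i))

      -- Extending 1/(Q;Q)_n by 0 to negative n keeps its recurrence valid.
      Vℤ : ℤ → Carrier
      Vℤ (+ n)    = V n
      Vℤ -[1+ n ] = 0#

      coeff : ℕ → ℤ → Carrier
      coeff N k = Vℤ (+ N ℤ.+ k) * Vℤ (+ N ℤ.- k)

      d+q^≈1 : ∀ n → d n + q ^ (m ℕ.* n) ≈ 1#
      d+q^≈1 n = 1-x+x≈1 _

      d0≈0 : d 0 ≈ 0#
      d0≈0 = begin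
        1# + - 1# * q ^ (m ℕ.* 0)   ≈⟨ +-congˡ (*-congˡ (^-congʳ q (ℕP.*-zeroʳ m))) ⟩
        1# + - 1# * 1#              ≈⟨ +-congˡ (*-identityʳ _) ⟩
        1# + - 1#                   ≈⟨ -‿inverseʳ 1# ⟩
        0#                          ∎

      d-geo : ∀ i → d (suc i) * geo (m ℕ.* suc i) ≈ 1#
      d-geo i with m ℕ.* suc i | ℕP.m*n≢0 m (suc i)
      ... | suc k | _ = geo-inverse k

      PV≈1 : ∀ n → P n * V n ≈ 1#
      PV≈1 n = trans (sym (Π<-* n _ _)) (Π<-one n _ d-geo)

      Vℤ-pred : ∀ n → Vℤ (+ n ℤ.+ -[1+ 0 ]) ≈ d n * V n
      Vℤ-pred zero    = sym (trans (*-congʳ d0≈0) (zeroˡ _))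
      Vℤ-pred (suc n) = sym (begin
        d (suc n) * (V n * geo (m ℕ.* suc n))   ≈⟨ solve 3 (λ x y z → x :* (y :* z) := y :* (x :* z)) refl _ _ _ ⟩
        V n * (d (suc n) * geo (m ℕ.* suc n))   ≈⟨ *-congˡ (d-geo n) ⟩
        V n * 1#                                ≈⟨ *-identityʳ _ ⟩
        V n                                     ∎)

      q^m*-+ : ∀ i j → q ^ (m ℕ.* (i ℕ.+ j)) ≈ q ^ (m ℕ.* i) * q ^ (m ℕ.* j)
      q^m*-+ i j = trans (^-congʳ q (ℕP.*-distribˡ-+ m i j)) (^-homo-* q (m ℕ.* i) (m ℕ.* j))

      -- Two downward steps give 1/(Q;Q)_{i-2} = (1 - Q^(i-1))(1 - Q^i)/(Q;Q)_i, and Q^j (1 -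
      -- Q^(i-1)) = Q^j - Q^n. The subtracted term is moved to the left, so that only semiring
      -- identities remain.
      Vℤ-pred₂ : ∀ i j n → i ℕ.+ j ≡ suc n →
        q ^ (m ℕ.* j) * Vℤ (+ i ℤ.+ -[1+ 1 ]) + q ^ (m ℕ.* n) * d i * V i ≈ d i * q ^ (m ℕ.* j) * V i
      Vℤ-pred₂ zero j n eq = begin
        q ^ (m ℕ.* j) * 0# + q ^ (m ℕ.* n) * d 0 * V 0
          ≈⟨ +-congˡ (*-congʳ (*-congˡ d0≈0)) ⟩
        q ^ (m ℕ.* j) * 0# + q ^ (m ℕ.* n) * 0# * V 0
          ≈⟨ solve 3 (λ x y z → x :* con 0 :+ y :* con 0 :* z := con 0 :* x :* z) refl _ _ _ ⟩
        0# * q ^ (m ℕ.* j) * V 0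
          ≈⟨ *-congʳ (*-congʳ d0≈0) ⟨
        d 0 * q ^ (m ℕ.* j) * V 0 ∎
      Vℤ-pred₂ (suc i) j n eq = begin
        q ^ (m ℕ.* j) * Vℤ (+ suc i ℤ.+ -[1+ 1 ]) + q ^ (m ℕ.* n) * d (suc i) * V (suc i)
          ≈⟨ +-cong (*-congˡ (trans (reflexive (≡.cong Vℤ (≡.sym (suc-pred₂ i)))) (trans (Vℤ-pred i) (*-congˡ (Vℤ-pred (suc i))))))
                    (*-congʳ (*-congʳ (trans (^-congʳ q (≡.cong (m ℕ.*_) (≡.sym (ℕP.suc-injective eq)))) (q^m*-+ i j)))) ⟩
        q ^ (m ℕ.* j) * (d i * (d (suc i) * V (suc i))) + q ^ (m ℕ.* i) * q ^ (m ℕ.* j) * d (suc i) * V (suc i)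
          ≈⟨ solve 5 (λ v a′ a x u′ → v :* (a′ :* (a :* x)) :+ u′ :* v :* a :* x := (a′ :+ u′) :* (a :* v :* x)) refl _ _ _ _ _ ⟩
        (d i + q ^ (m ℕ.* i)) * (d (suc i) * q ^ (m ℕ.* j) * V (suc i))
          ≈⟨ *-congʳ (d+q^≈1 i) ⟩
        1# * (d (suc i) * q ^ (m ℕ.* j) * V (suc i))
          ≈⟨ *-identityˡ _ ⟩
        d (suc i) * q ^ (m ℕ.* j) * V (suc i) ∎
        where
        suc-pred₂ : ∀ i → + i ℤ.+ -[1+ 0 ] ≡ + suc i ℤ.+ -[1+ 1 ]
        suc-pred₂ zero    = ≡.refl
        suc-pred₂ (suc i) = ≡.refl

      -- With u = Q^i, v = Q^j and w = Q^(i+j−1) this is the identity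
      -- (1 + w)(1 − u)(1 − v) + (v − w)(1 − u) + (u − w)(1 − v) = (1 − w)(1 − uv).
      V-recurrence : ∀ i j n → i ℕ.+ j ≡ suc n →
        (1# + q ^ (m ℕ.* n)) * (Vℤ (+ i ℤ.+ -[1+ 0 ]) * Vℤ (+ j ℤ.+ -[1+ 0 ]))
          + q ^ (m ℕ.* j) * (Vℤ (+ i ℤ.+ -[1+ 1 ]) * V j)
          + q ^ (m ℕ.* i) * (V i * Vℤ (+ j ℤ.+ -[1+ 1 ]))
        ≈ d n * d (suc n) * (V i * V j)
      -- Adding w(1 - u) + w(1 - v) to both sides turns the coefficients v - w and u - w into v and
      -- u, which removes the subtractions.
      V-recurrence i j n eq = ∙-cancelʳ (w * (α + β) * (V i * V j)) _ _ (begin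
        (1# + w) * (Vℤ (+ i ℤ.+ -[1+ 0 ]) * Vℤ (+ j ℤ.+ -[1+ 0 ])) + v * (x * V j) + u * (V i * y) + w * (α + β) * (V i * V j)
          ≈⟨ +-congʳ (+-congʳ (+-congʳ (*-congˡ (*-cong (Vℤ-pred i) (Vℤ-pred j))))) ⟩
        (1# + w) * (α * V i * (β * V j)) + v * (x * V j) + u * (V i * y) + w * (α + β) * (V i * V j)
          ≈⟨ solve 9 (λ w α β vi vj u v x y →
               (con 1 :+ w) :* (α :* vi :* (β :* vj)) :+ v :* (x :* vj) :+ u :* (vi :* y) :+ w :* (α :+ β) :* (vi :* vj) :=
               (con 1 :+ w) :* (α :* β) :* (vi :* vj) :+ (v :* x :+ w :* α :* vi) :* vj :+ (u :* y :+ w :* β :* vj) :* vi)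
               refl _ _ _ _ _ _ _ _ _ ⟩
        (1# + w) * (α * β) * (V i * V j) + (v * x + w * α * V i) * V j + (u * y + w * β * V j) * V i
          ≈⟨ +-cong (+-congˡ (*-congʳ (Vℤ-pred₂ i j n eq))) (*-congʳ (Vℤ-pred₂ j i n (≡.trans (ℕP.+-comm j i) eq))) ⟩
        (1# + w) * (α * β) * (V i * V j) + α * v * V i * V j + β * u * V j * V i
          ≈⟨ solve 7 (λ w α β vi vj u v →
               (con 1 :+ w) :* (α :* β) :* (vi :* vj) :+ α :* v :* vi :* vj :+ β :* u :* vj :* vi :=
               ((α :* β :+ α :* v :+ β :* u) :+ w :* (α :* β)) :* (vi :* vj)) refl _ _ _ _ _ _ _ ⟩
        ((α * β + α * v + β * u) + w * (α * β)) * (V i * V j)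
          ≈⟨ *-congʳ (+-congʳ γ-expand) ⟨
        (γ + w * (α * β)) * (V i * V j)
          ≈⟨ *-congʳ (+-congʳ (trans (*-congʳ (d+q^≈1 n)) (*-identityˡ γ))) ⟨
        ((d n + w) * γ + w * (α * β)) * (V i * V j)
          ≈⟨ solve 6 (λ δ w γ α β z → ((δ :+ w) :* γ :+ w :* (α :* β)) :* z :=
               δ :* γ :* z :+ w :* (γ :+ α :* β) :* z) refl _ _ _ _ _ _ ⟩
        d n * γ * (V i * V j) + w * (γ + α * β) * (V i * V j)
          ≈⟨ +-congˡ (*-congʳ (*-congˡ γ+αβ)) ⟩
        d n * γ * (V i * V j) + w * (α + β) * (V i * V j) ∎)
        where
        u = q ^ (m ℕ.* i)
        v = q ^ (m ℕ.* j)
        w = q ^ (m ℕ.* n)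
        x = Vℤ (+ i ℤ.+ -[1+ 1 ])
        y = Vℤ (+ j ℤ.+ -[1+ 1 ])
        α = d i
        β = d j
        γ = d (suc n)
        γ-expand : γ ≈ α * β + α * v + β * u
        γ-expand = ∙-cancelʳ (u * v) _ _ (begin
          γ + u * v                          ≈⟨ +-congˡ (sym (trans (^-congʳ q (≡.cong (m ℕ.*_) (≡.sym eq))) (q^m*-+ i j))) ⟩
          γ + q ^ (m ℕ.* suc n)              ≈⟨ d+q^≈1 (suc n) ⟩
          1#                                 ≈⟨ *-identityˡ 1# ⟨
          1# * 1#                            ≈⟨ *-cong (d+q^≈1 i) (d+q^≈1 j) ⟨
          (α + u) * (β + v)                  ≈⟨ solve 4 (λ α β u v → (α :+ u) :* (β :+ v) := α :* β :+ α :* v :+ β :* u :+ u :* v) refl _ _ _ _ ⟩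
          α * β + α * v + β * u + u * v      ∎)
        γ+αβ : γ + α * β ≈ α + β
        γ+αβ = begin
          γ + α * β                                ≈⟨ +-congʳ γ-expand ⟩
          α * β + α * v + β * u + α * β            ≈⟨ solve 4 (λ α β u v → α :* β :+ α :* v :+ β :* u :+ α :* β := α :* (β :+ v) :+ β :* (α :+ u)) refl _ _ _ _ ⟩
          α * (β + v) + β * (α + u)                ≈⟨ +-cong (*-congˡ (d+q^≈1 j)) (*-congˡ (d+q^≈1 i)) ⟩
          α * 1# + β * 1#                          ≈⟨ +-cong (*-identityʳ α) (*-identityʳ β) ⟩
          α + β                                    ∎

      -- If `I` or `J` is negative, every product contains a zero value of `Vℤ`, so the absolute
      -- values in the exponents are harmless there.
      Vℤ-recurrence : ∀ I J n → I ℤ.+ J ≡ + suc n →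
        (1# + q ^ (m ℕ.* n)) * (Vℤ (I ℤ.+ -[1+ 0 ]) * Vℤ (J ℤ.+ -[1+ 0 ]))
          + q ^ (m ℕ.* ∣ J ∣) * (Vℤ (I ℤ.+ -[1+ 1 ]) * Vℤ J)
          + q ^ (m ℕ.* ∣ I ∣) * (Vℤ I * Vℤ (J ℤ.+ -[1+ 1 ]))
        ≈ d n * d (suc n) * (Vℤ I * Vℤ J)
      Vℤ-recurrence (+ i)    (+ j)    n eq = V-recurrence i j n (ℤP.+-injective eq)
      Vℤ-recurrence -[1+ i ] J        n eq =
        solve 8 (λ w a b c e f g k → w :* (con 0 :* a) :+ b :* (con 0 :* c) :+ e :* (con 0 :* f) := g :* k :* (con 0 :* c))
          refl _ _ _ _ _ _ _ _
      Vℤ-recurrence (+ i)    -[1+ j ] n eq =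
        solve 8 (λ w a b c e f g k → w :* (a :* con 0) :+ b :* (c :* con 0) :+ e :* (f :* con 0) := g :* k :* (f :* con 0))
          refl _ _ _ _ _ _ _ _

      -- When the sum is multiplied by the new factors 1 + A and 1 + B, `shiftˡ N k` is what A
      -- carries from index k - 1 to k, and `shiftʳ N k` what B carries from k + 1 to k.
      shiftˡ shiftʳ : ℕ → ℤ → Carrier
      shiftˡ N k = term k * (q ^ (m ℕ.* ∣ (+ 1 ℤ.+ + N) ℤ.- k ∣) * coeff N (k ℤ.+ -[1+ 0 ]))
      shiftʳ N k = term k * (q ^ (m ℕ.* ∣ (+ 1 ℤ.+ + N) ℤ.+ k ∣) * coeff N (k ℤ.+ + 1))

      -- Two q-Pascal steps at once, from row 2N to row 2N + 2: `Vℤ-recurrence` at I = N + 1 + k and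
      -- J = N + 1 - k.
      coeff-recurrence : ∀ N k →
        (1# + q ^ (m ℕ.* suc (N ℕ.* 2))) * coeff N k
          + q ^ (m ℕ.* ∣ (+ 1 ℤ.+ + N) ℤ.- k ∣) * coeff N (k ℤ.+ -[1+ 0 ])
          + q ^ (m ℕ.* ∣ (+ 1 ℤ.+ + N) ℤ.+ k ∣) * coeff N (k ℤ.+ + 1)
        ≈ d (suc (N ℕ.* 2)) * d (suc (suc (N ℕ.* 2))) * coeff (suc N) k
      coeff-recurrence N k = trans
        (+-cong (+-cong (*-congˡ (*-cong (vz (s₁ (+ N) k)) (vz (s₂ (+ N) k))))
                        (*-congˡ (*-cong (vz (s₃ (+ N) k)) (vz (s₄ (+ N) k)))))
                (*-congˡ (*-cong (vz (s₅ (+ N) k)) (vz (s₆ (+ N) k)))))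
        (Vℤ-recurrence ((+ 1 ℤ.+ + N) ℤ.+ k) ((+ 1 ℤ.+ + N) ℤ.- k) (suc (N ℕ.* 2))
          (≡.trans (s₇ (+ N) k) (≡.cong (ℤ._+_ (+ 2)) (≡.sym (ℤP.pos-* N 2)))))
        where
        vz : ∀ {x y} → x ≡ y → Vℤ x ≈ Vℤ y
        vz eq = reflexive (≡.cong Vℤ eq)
        s₁ : ∀ N k → N ℤ.+ k ≡ ((+ 1 ℤ.+ N) ℤ.+ k) ℤ.+ -[1+ 0 ]
        s₁ = solve-∀
        s₂ : ∀ N k → N ℤ.- k ≡ ((+ 1 ℤ.+ N) ℤ.- k) ℤ.+ -[1+ 0 ]
        s₂ = solve-∀
        s₃ : ∀ N k → N ℤ.+ (k ℤ.+ -[1+ 0 ]) ≡ ((+ 1 ℤ.+ N) ℤ.+ k) ℤ.+ -[1+ 1 ]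
        s₃ = solve-∀
        s₄ : ∀ N k → N ℤ.- (k ℤ.+ -[1+ 0 ]) ≡ (+ 1 ℤ.+ N) ℤ.- k
        s₄ = solve-∀
        s₅ : ∀ N k → N ℤ.+ (k ℤ.+ + 1) ≡ (+ 1 ℤ.+ N) ℤ.+ k
        s₅ = solve-∀
        s₆ : ∀ N k → N ℤ.- (k ℤ.+ + 1) ≡ ((+ 1 ℤ.+ N) ℤ.- k) ℤ.+ -[1+ 1 ]
        s₆ = solve-∀
        s₇ : ∀ N k → ((+ 1 ℤ.+ N) ℤ.+ k) ℤ.+ ((+ 1 ℤ.+ N) ℤ.- k) ≡ + 2 ℤ.+ N ℤ.* + 2
        s₇ = solve-∀

      Vℤ-⊖ : ∀ {x y} → x ℕ.< y → Vℤ (x ℤ.⊖ y) ≈ 0#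
      Vℤ-⊖ {x} {y} x<y = trans (reflexive (≡.cong Vℤ (ℤP.⊖-< x<y))) (neg (ℕP.m<n⇒0<n∸m x<y))
        where
        neg : ∀ {n} → 0 ℕ.< n → Vℤ (ℤ.- (+ n)) ≈ 0#
        neg {suc n} _ = refl

      coeff-vanishes : ∀ N → Vanishes (coeff N) (suc N)
      coeff-vanishes N (+ n) lt =
        trans (*-congˡ (trans (reflexive (≡.cong Vℤ (ℤP.m-n≡m⊖n N n))) (Vℤ-⊖ lt))) (zeroʳ _)
      coeff-vanishes N -[1+ n ] lt = trans (*-congʳ (Vℤ-⊖ lt)) (zeroˡ _)

      shiftˡ-vanishes : ∀ N → Vanishes (shiftˡ N) (suc N ℕ.+ 1)
      shiftˡ-vanishes N k le = trans
        (*-congˡ (trans (*-congˡ (Vanishes-shift {coeff N} {suc N} -[1+ 0 ] (coeff-vanishes N) k le)) (zeroʳ _)))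
        (zeroʳ _)

      shiftʳ-vanishes : ∀ N → Vanishes (shiftʳ N) (suc N ℕ.+ 1)
      shiftʳ-vanishes N k le = trans
        (*-congˡ (trans (*-congˡ (Vanishes-shift {coeff N} {suc N} (+ 1) (coeff-vanishes N) k le)) (zeroʳ _)))
        (zeroʳ _)

      term-coeff-suc : ∀ N k → σ * q ^ (a ℕ.+ m ℕ.* N) * (term k * coeff N k) ≈ shiftˡ N (k ℤ.+ + 1)
      term-coeff-suc N k = trans (raise (+ N ℤ.- k) ≡.refl)
        (*-congˡ (*-cong (reflexive (≡.cong (λ z → q ^ (m ℕ.* ∣ z ∣)) (s₁ (+ N) k)))
                         (reflexive (≡.cong (coeff N) (s₂ k)))))
        where
        s₁ : ∀ N k → N ℤ.- k ≡ (+ 1 ℤ.+ N) ℤ.- (k ℤ.+ + 1)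
        s₁ = solve-∀
        s₂ : ∀ k → k ≡ (k ℤ.+ + 1) ℤ.+ -[1+ 0 ]
        s₂ = solve-∀
        raise : ∀ J → + N ℤ.- k ≡ J → σ * q ^ (a ℕ.+ m ℕ.* N) * (term k * (Vℤ (+ N ℤ.+ k) * Vℤ (+ N ℤ.- k))) ≈
          term (k ℤ.+ + 1) * (q ^ (m ℕ.* ∣ + N ℤ.- k ∣) * coeff N k)
        -- For k > N the factor 1/(Q;Q)_{N-k} is 0 on both sides; the exponent law speaks only of N
        -- - k ≥ 0.
        raise -[1+ j ] eq rewrite eq =
          solve 5 (λ x t v s y → x :* (t :* (v :* con 0)) := s :* (y :* (v :* con 0))) refl _ _ _ _ _
        raise (+ j) eq = begin
          σ * q ^ (a ℕ.+ m ℕ.* N) * (sgn k * q ^ e k * coeff N k)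
            ≈⟨ solve 5 (λ σ x s y c → σ :* x :* (s :* y :* c) := σ :* s :* (y :* x) :* c) refl _ _ _ _ _ ⟩
          σ * sgn k * (q ^ e k * q ^ (a ℕ.+ m ℕ.* N)) * coeff N k
            ≈⟨ *-congʳ (*-cong (sgn-suc k) exponents) ⟨
          sgn (k ℤ.+ + 1) * (q ^ e (k ℤ.+ + 1) * q ^ (m ℕ.* ∣ + N ℤ.- k ∣)) * coeff N k
            ≈⟨ solve 4 (λ s x y c → s :* (x :* y) :* c := s :* x :* (y :* c)) refl _ _ _ _ ⟩
          term (k ℤ.+ + 1) * (q ^ (m ℕ.* ∣ + N ℤ.- k ∣) * coeff N k) ∎
          where
          exponents : q ^ e (k ℤ.+ + 1) * q ^ (m ℕ.* ∣ + N ℤ.- k ∣) ≈ q ^ e k * q ^ (a ℕ.+ m ℕ.* N)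
          exponents = begin
            q ^ e (k ℤ.+ + 1) * q ^ (m ℕ.* ∣ + N ℤ.- k ∣)   ≈⟨ *-congˡ (reflexive (≡.cong (λ z → q ^ (m ℕ.* ∣ z ∣)) eq)) ⟩
            q ^ e (k ℤ.+ + 1) * q ^ (m ℕ.* j)               ≈⟨ ^-homo-* q (e (k ℤ.+ + 1)) (m ℕ.* j) ⟨
            q ^ (e (k ℤ.+ + 1) ℕ.+ m ℕ.* j)                 ≈⟨ ^-congʳ q (thetaExp-suc h a b a+b≡h+h N k j eq) ⟨
            q ^ (e k ℕ.+ (a ℕ.+ m ℕ.* N))                   ≈⟨ ^-homo-* q (e k) (a ℕ.+ m ℕ.* N) ⟩
            q ^ e k * q ^ (a ℕ.+ m ℕ.* N)                   ∎

      term-coeff-pred : ∀ N k → σ * q ^ (b ℕ.+ m ℕ.* N) * (term k * coeff N k) ≈ shiftʳ N (k ℤ.+ -[1+ 0 ])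
      term-coeff-pred N k = trans (lower (+ N ℤ.+ k) ≡.refl)
        (*-congˡ (*-cong (reflexive (≡.cong (λ z → q ^ (m ℕ.* ∣ z ∣)) (s₁ (+ N) k)))
                         (reflexive (≡.cong (coeff N) (s₂ k)))))
        where
        s₁ : ∀ N k → N ℤ.+ k ≡ (+ 1 ℤ.+ N) ℤ.+ (k ℤ.+ -[1+ 0 ])
        s₁ = solve-∀
        s₂ : ∀ k → k ≡ (k ℤ.+ -[1+ 0 ]) ℤ.+ + 1
        s₂ = solve-∀
        lower : ∀ J → + N ℤ.+ k ≡ J → σ * q ^ (b ℕ.+ m ℕ.* N) * (term k * (Vℤ (+ N ℤ.+ k) * Vℤ (+ N ℤ.- k))) ≈
          term (k ℤ.+ -[1+ 0 ]) * (q ^ (m ℕ.* ∣ + N ℤ.+ k ∣) * coeff N k)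
        lower -[1+ j ] eq rewrite eq =
          solve 5 (λ x t v s y → x :* (t :* (con 0 :* v)) := s :* (y :* (con 0 :* v))) refl _ _ _ _ _
        lower (+ j) eq = begin
          σ * q ^ (b ℕ.+ m ℕ.* N) * (sgn k * q ^ e k * coeff N k)
            ≈⟨ solve 5 (λ σ x s y c → σ :* x :* (s :* y :* c) := σ :* s :* (y :* x) :* c) refl _ _ _ _ _ ⟩
          σ * sgn k * (q ^ e k * q ^ (b ℕ.+ m ℕ.* N)) * coeff N k
            ≈⟨ *-congʳ (*-cong (sgn-pred k) exponents) ⟨
          sgn (k ℤ.+ -[1+ 0 ]) * (q ^ e (k ℤ.+ -[1+ 0 ]) * q ^ (m ℕ.* ∣ + N ℤ.+ k ∣)) * coeff N k
            ≈⟨ solve 4 (λ s x y c → s :* (x :* y) :* c := s :* x :* (y :* c)) refl _ _ _ _ ⟩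
          term (k ℤ.+ -[1+ 0 ]) * (q ^ (m ℕ.* ∣ + N ℤ.+ k ∣) * coeff N k) ∎
          where
          exponents : q ^ e (k ℤ.+ -[1+ 0 ]) * q ^ (m ℕ.* ∣ + N ℤ.+ k ∣) ≈ q ^ e k * q ^ (b ℕ.+ m ℕ.* N)
          exponents = begin
            q ^ e (k ℤ.+ -[1+ 0 ]) * q ^ (m ℕ.* ∣ + N ℤ.+ k ∣)   ≈⟨ *-congˡ (reflexive (≡.cong (λ z → q ^ (m ℕ.* ∣ z ∣)) eq)) ⟩
            q ^ e (k ℤ.+ -[1+ 0 ]) * q ^ (m ℕ.* j)               ≈⟨ ^-homo-* q (e (k ℤ.+ -[1+ 0 ])) (m ℕ.* j) ⟨
            q ^ (e (k ℤ.+ -[1+ 0 ]) ℕ.+ m ℕ.* j)                 ≈⟨ ^-congʳ q (thetaExp-pred h a b a+b≡h+h N k j eq) ⟨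
            q ^ (e k ℕ.+ (b ℕ.+ m ℕ.* N))                        ≈⟨ ^-homo-* q (e k) (b ℕ.+ m ℕ.* N) ⟩
            q ^ e k * q ^ (b ℕ.+ m ℕ.* N)                        ∎

      finiteSum : ℕ → ℕ → Carrier
      finiteSum K N = Σℤ K (λ k → term k * coeff N k)

      -- (1 + A)(1 + B) = (1 + AB) + A + B with AB = Q^(2N+1). Once the A and B parts are
      -- re-indexed, each term has the left side of `coeff-recurrence` as its coefficient. The bound
      -- on K is the support N + 2 of the shifted families plus one for the shift.
      finiteSum-step : ∀ K N → suc N ℕ.+ 1 ℕ.+ 1 ℕ.≤ K →
        (1# + σ * q ^ (a ℕ.+ m ℕ.* N)) * (1# + σ * q ^ (b ℕ.+ m ℕ.* N)) * finiteSum K N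
        ≈ d (suc (N ℕ.* 2)) * d (suc (suc (N ℕ.* 2))) * finiteSum K (suc N)
      finiteSum-step K N le = begin
        (1# + A) * (1# + B) * finiteSum K N
          ≈⟨ Σℤ-*ˡ K _ _ ⟩
        Σℤ K (λ k → (1# + A) * (1# + B) * (term k * coeff N k))
          ≈⟨ Σℤ-cong K (λ k _ → expand k) ⟩
        Σℤ K (λ k → term k * ((1# + w) * coeff N k) + shiftˡ N (k ℤ.+ + 1) + shiftʳ N (k ℤ.+ -[1+ 0 ]))
          ≈⟨ trans (Σℤ-+ K _ _) (+-congʳ (Σℤ-+ K _ _)) ⟩
        Σℤ K (λ k → term k * ((1# + w) * coeff N k)) + Σℤ K (λ k → shiftˡ N (k ℤ.+ + 1)) + Σℤ K (λ k → shiftʳ N (k ℤ.+ -[1+ 0 ]))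
          ≈⟨ +-cong (+-congˡ (Σℤ-shift (shiftˡ N) (+ 1) (shiftˡ-vanishes N) le))
                    (Σℤ-shift (shiftʳ N) -[1+ 0 ] (shiftʳ-vanishes N) le) ⟩
        Σℤ K (λ k → term k * ((1# + w) * coeff N k)) + Σℤ K (shiftˡ N) + Σℤ K (shiftʳ N)
          ≈⟨ sym (trans (Σℤ-+ K _ _) (+-congʳ (Σℤ-+ K _ _))) ⟩
        Σℤ K (λ k → term k * ((1# + w) * coeff N k) + shiftˡ N k + shiftʳ N k)
          ≈⟨ Σℤ-cong K (λ k _ → collect k) ⟩
        Σℤ K (λ k → d (suc (N ℕ.* 2)) * d (suc (suc (N ℕ.* 2))) * (term k * coeff (suc N) k))
          ≈⟨ Σℤ-*ˡ K _ _ ⟨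
        d (suc (N ℕ.* 2)) * d (suc (suc (N ℕ.* 2))) * finiteSum K (suc N) ∎
        where
        A = σ * q ^ (a ℕ.+ m ℕ.* N)
        B = σ * q ^ (b ℕ.+ m ℕ.* N)
        w = q ^ (m ℕ.* suc (N ℕ.* 2))
        exponent : (a ℕ.+ m ℕ.* N) ℕ.+ (b ℕ.+ m ℕ.* N) ≡ m ℕ.* suc (N ℕ.* 2)
        exponent = ≡.trans (regroup a b m N) (≡.trans (≡.cong (ℕ._+ m ℕ.* (N ℕ.* 2)) a+b≡h+h) (≡.sym (ℕP.*-suc m (N ℕ.* 2))))
          where
          regroup : ∀ a b m N → (a ℕ.+ m ℕ.* N) ℕ.+ (b ℕ.+ m ℕ.* N) ≡ (a ℕ.+ b) ℕ.+ m ℕ.* (N ℕ.* 2)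
          regroup = ℕS.solve-∀
        AB≈w : A * B ≈ w
        AB≈w = begin
          A * B
            ≈⟨ solve 3 (λ s x y → s :* x :* (s :* y) := s :* s :* (x :* y)) refl _ _ _ ⟩
          σ * σ * (q ^ (a ℕ.+ m ℕ.* N) * q ^ (b ℕ.+ m ℕ.* N))
            ≈⟨ *-cong σσ≈1 (sym (^-homo-* q (a ℕ.+ m ℕ.* N) (b ℕ.+ m ℕ.* N))) ⟩
          1# * q ^ ((a ℕ.+ m ℕ.* N) ℕ.+ (b ℕ.+ m ℕ.* N))
            ≈⟨ trans (*-identityˡ _) (^-congʳ q exponent) ⟩
          w ∎
        expand : ∀ k → (1# + A) * (1# + B) * (term k * coeff N k) ≈
          term k * ((1# + w) * coeff N k) + shiftˡ N (k ℤ.+ + 1) + shiftʳ N (k ℤ.+ -[1+ 0 ])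
        expand k = begin
          (1# + A) * (1# + B) * (term k * coeff N k)
            ≈⟨ solve 4 (λ a b t c → (con 1 :+ a) :* (con 1 :+ b) :* (t :* c) :=
                 t :* ((con 1 :+ a :* b) :* c) :+ a :* (t :* c) :+ b :* (t :* c)) refl _ _ _ _ ⟩
          term k * ((1# + A * B) * coeff N k) + A * (term k * coeff N k) + B * (term k * coeff N k)
            ≈⟨ +-cong (+-cong (*-congˡ (*-congʳ (+-congˡ AB≈w))) (term-coeff-suc N k)) (term-coeff-pred N k) ⟩
          term k * ((1# + w) * coeff N k) + shiftˡ N (k ℤ.+ + 1) + shiftʳ N (k ℤ.+ -[1+ 0 ]) ∎
        collect : ∀ k → term k * ((1# + w) * coeff N k) + shiftˡ N k + shiftʳ N k ≈
          d (suc (N ℕ.* 2)) * d (suc (suc (N ℕ.* 2))) * (term k * coeff (suc N) k)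
        collect k = begin
          term k * ((1# + w) * coeff N k) + shiftˡ N k + shiftʳ N k
            ≈⟨ sym (trans (distribˡ _ _ _) (+-congʳ (distribˡ _ _ _))) ⟩
          term k * ((1# + w) * coeff N k + _ + _)
            ≈⟨ *-congˡ (coeff-recurrence N k) ⟩
          term k * (d (suc (N ℕ.* 2)) * d (suc (suc (N ℕ.* 2))) * coeff (suc N) k)
            ≈⟨ solve 3 (λ t x c → t :* (x :* c) := x :* (t :* c)) refl _ _ _ ⟩
          d (suc (N ℕ.* 2)) * d (suc (suc (N ℕ.* 2))) * (term k * coeff (suc N) k) ∎

      -- Cauchy's finite form: P (2N) * coeff N k is the q-binomial coefficient [2N ; N + k] in base q^m.
      finite-jacobi-triple : ∀ K N → N ℕ.+ 2 ℕ.≤ K →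
        poch N σ a m * poch N σ b m ≈ P (N ℕ.* 2) * finiteSum K N
      finite-jacobi-triple K zero le = begin
        1# * 1#                                            ≈⟨ *-congˡ (sym base) ⟩
        1# * finiteSum K 0                                 ∎
        where
        base : finiteSum K 0 ≈ 1#
        base = begin
          finiteSum K 0
            ≈⟨ Σℤ-extend _ (ℕP.≤-trans (ℕP.n≤1+n 1) le)
                 (λ k 1≤k → trans (*-congˡ (coeff-vanishes 0 k 1≤k)) (zeroʳ _)) ⟩
          0# + (1# * 1# * (1# * 1#) + term -[1+ 0 ] * (0# * V 1))
            ≈⟨ solve 2 (λ x y → con 0 :+ (con 1 :* con 1 :* (con 1 :* con 1) :+ x :* (con 0 :* y)) := con 1) refl _ _ ⟩
          1# ∎
      finite-jacobi-triple K (suc N) le = begin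
        (poch N σ a m * (1# + σ * q ^ (a ℕ.+ m ℕ.* N))) * (poch N σ b m * (1# + σ * q ^ (b ℕ.+ m ℕ.* N)))
          ≈⟨ solve 4 (λ x y u v → (x :* u) :* (y :* v) := (x :* y) :* (u :* v)) refl _ _ _ _ ⟩
        (poch N σ a m * poch N σ b m) * ((1# + σ * q ^ (a ℕ.+ m ℕ.* N)) * (1# + σ * q ^ (b ℕ.+ m ℕ.* N)))
          ≈⟨ *-congʳ (finite-jacobi-triple K N (ℕP.≤-trans (ℕP.n≤1+n _) le)) ⟩
        (P (N ℕ.* 2) * finiteSum K N) * ((1# + σ * q ^ (a ℕ.+ m ℕ.* N)) * (1# + σ * q ^ (b ℕ.+ m ℕ.* N)))
          ≈⟨ solve 3 (λ p s x → (p :* s) :* x := p :* (x :* s)) refl _ _ _ ⟩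
        P (N ℕ.* 2) * ((1# + σ * q ^ (a ℕ.+ m ℕ.* N)) * (1# + σ * q ^ (b ℕ.+ m ℕ.* N)) * finiteSum K N)
          ≈⟨ *-congˡ (finiteSum-step K N (ℕP.≤-trans (ℕP.≤-reflexive (ℕP.+-assoc (suc N) 1 1)) le)) ⟩
        P (N ℕ.* 2) * (d (suc (N ℕ.* 2)) * d (suc (suc (N ℕ.* 2))) * finiteSum K (suc N))
          ≈⟨ solve 4 (λ p x y s → p :* (x :* y :* s) := p :* x :* y :* s) refl _ _ _ _ ⟩
        P (suc N ℕ.* 2) * finiteSum K (suc N) ∎

      term-vanishes : Vanishes term M
      term-vanishes k M≤k = trans (*-congˡ (q^-zero (ℕP.≤-trans M≤k (∣k∣≤thetaExp h a b k)))) (zeroʳ _)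

      P≈poch : ∀ n → P n ≈ poch n (- 1#) m m
      P≈poch n = Π<-cong n (λ i → +-congˡ (*-congˡ (^-congʳ q (ℕP.*-suc m i))))

      P-extend : ∀ {n} → M ℕ.≤ n → P n ≈ P M
      P-extend {n} M≤n = trans (P≈poch n) (trans (poch-extend (- 1#) m m M≤n) (sym (P≈poch M)))

      -- Inverses are unique, so `V` becomes stationary because `P` does; `geo` is known only
      -- through its products with 1 - q^k.
      V-extend : ∀ {n} → M ℕ.≤ n → V n ≈ V M
      V-extend {n} M≤n = begin
        V n                    ≈⟨ *-identityʳ _ ⟨
        V n * 1#               ≈⟨ *-congˡ (PV≈1 M) ⟨
        V n * (P M * V M)      ≈⟨ *-congˡ (*-congʳ (P-extend M≤n)) ⟨
        V n * (P n * V M)      ≈⟨ solve 3 (λ x y z → x :* (y :* z) := (y :* x) :* z) refl _ _ _ ⟩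
        (P n * V n) * V M      ≈⟨ *-congʳ (PV≈1 n) ⟩
        1# * V M               ≈⟨ *-identityˡ _ ⟩
        V M                    ∎

      -- At N = 2M both N + k and N - k are at least M, beyond which 1/(Q;Q)_n is stationary.
      coeff-limit : ∀ k → ∣ k ∣ ℕ.≤ M → coeff (M ℕ.+ M) k ≈ V M * V M
      coeff-limit k k≤M = *-cong (limit k k≤M) (limit (ℤ.- k) (≡.subst (ℕ._≤ M) (≡.sym (ℤP.∣-i∣≡∣i∣ k)) k≤M))
        where
        limit : ∀ k → ∣ k ∣ ℕ.≤ M → Vℤ (+ (M ℕ.+ M) ℤ.+ k) ≈ V M
        limit (+ n)    _  = V-extend (ℕP.≤-trans (ℕP.m≤m+n M M) (ℕP.m≤m+n (M ℕ.+ M) n))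
        limit -[1+ n ] le = trans (reflexive (≡.cong Vℤ (ℤP.⊖-≥ (ℕP.≤-trans le (ℕP.m≤m+n M M)))))
          (V-extend (≡.subst (M ℕ.≤_) (≡.sym (ℕP.+-∸-assoc M le)) (ℕP.m≤m+n M _)))

      -- In Cauchy's form at N = 2M the sum acquires the constant factor `P M * (V M * V M)`, that
      -- is 1/(Q;Q)_∞, which the third product cancels.
      jacobi-triple : ∀ {K} → M ℕ.≤ K → Σℤ K term ≈ poch M σ a m * poch M σ b m * poch M (- 1#) m m
      jacobi-triple {K} M≤K = sym (begin
        poch M σ a m * poch M σ b m * poch M (- 1#) m m
          ≈⟨ *-cong (*-cong (poch-extend σ a m M≤N) (poch-extend σ b m M≤N)) (P≈poch M) ⟨
        poch N σ a m * poch N σ b m * P M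
          ≈⟨ *-congʳ (finite-jacobi-triple (N ℕ.+ 2) N ℕP.≤-refl) ⟩
        P (N ℕ.* 2) * finiteSum (N ℕ.+ 2) N * P M
          ≈⟨ *-congʳ (*-cong (P-extend (ℕP.≤-trans M≤N (ℕP.m≤m*n N 2))) limit) ⟩
        P M * (V M * V M * Σℤ M term) * P M
          ≈⟨ solve 3 (λ p v s → p :* (v :* v :* s) :* p := (p :* v) :* ((p :* v) :* s)) refl _ _ _ ⟩
        (P M * V M) * ((P M * V M) * Σℤ M term)
          ≈⟨ *-cong (PV≈1 M) (*-congʳ (PV≈1 M)) ⟩
        1# * (1# * Σℤ M term)
          ≈⟨ trans (*-identityˡ _) (*-identityˡ _) ⟩
        Σℤ M term
          ≈⟨ Σℤ-extend term M≤K term-vanishes ⟨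
        Σℤ K term ∎)
        where
        N = M ℕ.+ M
        M≤N = ℕP.m≤m+n M M
        limit : finiteSum (N ℕ.+ 2) N ≈ V M * V M * Σℤ M term
        limit = begin
          finiteSum (N ℕ.+ 2) N
            ≈⟨ Σℤ-extend _ (ℕP.≤-trans M≤N (ℕP.m≤m+n N 2)) (λ k M≤k → trans (*-congʳ (term-vanishes k M≤k)) (zeroˡ _)) ⟩
          finiteSum M N
            ≈⟨ Σℤ-cong M (λ k k≤M → trans (*-congˡ (coeff-limit k k≤M)) (*-comm _ _)) ⟩
          Σℤ M (λ k → V M * V M * term k)
            ≈⟨ Σℤ-*ˡ M _ term ⟨
          V M * V M * Σℤ M term ∎

    -- Infinite products, their dissections, and ψ

    -- (q^a ; q^m)_∞ and (−q^a ; q^m)_∞: as q^M ≈ 0, only the first M factors matter.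
    O O⁺ : ℕ → ℕ → Carrier
    O  = poch M (- 1#)
    O⁺ = poch M 1#

    O⁻¹ : ℕ → ℕ → Carrier
    O⁻¹ a m = Π< M (λ i → geo (a ℕ.+ m ℕ.* i))

    OO⁻¹≈1 : ∀ a m → O (suc a) m * O⁻¹ (suc a) m ≈ 1#
    OO⁻¹≈1 a m = trans (sym (Π<-* M _ _)) (Π<-one M _ (λ i → geo-inverse (a ℕ.+ m ℕ.* i)))

    poch-dissect₂ : ∀ σ a m {{_ : ℕ.NonZero m}} →
      poch M σ a m ≈ poch M σ a (m ℕ.+ m) * poch M σ (a ℕ.+ m) (m ℕ.+ m)
    poch-dissect₂ σ a m = begin
      poch M σ a m                 ≈⟨ poch-extend σ a m (ℕP.m≤m*n M 2) ⟨
      poch (M ℕ.* 2) σ a m         ≈⟨ Π<-split₂ M _ ⟩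
      _                            ≈⟨ *-cong (Π<-cong M (λ i → +-congˡ (*-congˡ (^-congʳ q (s₀ a m i)))))
                                             (Π<-cong M (λ i → +-congˡ (*-congˡ (^-congʳ q (s₁ a m i))))) ⟩
      poch M σ a (m ℕ.+ m) * poch M σ (a ℕ.+ m) (m ℕ.+ m) ∎
      where
      s₀ : ∀ a m i → a ℕ.+ m ℕ.* (i ℕ.* 2) ≡ a ℕ.+ (m ℕ.+ m) ℕ.* i
      s₀ = ℕS.solve-∀
      s₁ : ∀ a m i → a ℕ.+ m ℕ.* (1 ℕ.+ i ℕ.* 2) ≡ (a ℕ.+ m) ℕ.+ (m ℕ.+ m) ℕ.* i
      s₁ = ℕS.solve-∀

    poch-dissect₅ : ∀ σ a m {{_ : ℕ.NonZero m}} → let m′ = 5 ℕ.* m in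
      poch M σ a m ≈ poch M σ a m′ * poch M σ (a ℕ.+ m) m′ * poch M σ (a ℕ.+ 2 ℕ.* m) m′
        * poch M σ (a ℕ.+ 3 ℕ.* m) m′ * poch M σ (a ℕ.+ 4 ℕ.* m) m′
    poch-dissect₅ σ a m = begin
      poch M σ a m                 ≈⟨ poch-extend σ a m (ℕP.m≤m*n M 5) ⟨
      poch (M ℕ.* 5) σ a m         ≈⟨ Π<-split₅ M _ ⟩
      _                            ≈⟨ *-cong (*-cong (*-cong (*-cong (exps (s₀ a m)) (exps (s₁ a m))) (exps (s₂ a m)))
                                               (exps (s₃ a m))) (exps (s₄ a m)) ⟩
      _                            ∎
      where
      exps : ∀ {f g : ℕ → ℕ} → (∀ i → f i ≡ g i) →
        Π< M (λ i → 1# + σ * q ^ f i) ≈ Π< M (λ i → 1# + σ * q ^ g i)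
      exps p = Π<-cong M (λ i → +-congˡ (*-congˡ (^-congʳ q (p i))))
      s₀ : ∀ a m i → a ℕ.+ m ℕ.* (i ℕ.* 5) ≡ a ℕ.+ 5 ℕ.* m ℕ.* i
      s₀ = ℕS.solve-∀
      s₁ : ∀ a m i → a ℕ.+ m ℕ.* (1 ℕ.+ i ℕ.* 5) ≡ (a ℕ.+ m) ℕ.+ 5 ℕ.* m ℕ.* i
      s₁ = ℕS.solve-∀
      s₂ : ∀ a m i → a ℕ.+ m ℕ.* (2 ℕ.+ i ℕ.* 5) ≡ (a ℕ.+ 2 ℕ.* m) ℕ.+ 5 ℕ.* m ℕ.* i
      s₂ = ℕS.solve-∀
      s₃ : ∀ a m i → a ℕ.+ m ℕ.* (3 ℕ.+ i ℕ.* 5) ≡ (a ℕ.+ 3 ℕ.* m) ℕ.+ 5 ℕ.* m ℕ.* i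
      s₃ = ℕS.solve-∀
      s₄ : ∀ a m i → a ℕ.+ m ℕ.* (4 ℕ.+ i ℕ.* 5) ≡ (a ℕ.+ 4 ℕ.* m) ℕ.+ 5 ℕ.* m ℕ.* i
      s₄ = ℕS.solve-∀

    OO⁺ : ∀ a m → O a m * O⁺ a m ≈ O (a ℕ.+ a) (m ℕ.+ m)
    OO⁺ a m = trans (sym (Π<-* M _ _)) (Π<-cong M factor)
      where
      double : ∀ a m i → (a ℕ.+ m ℕ.* i) ℕ.+ (a ℕ.+ m ℕ.* i) ≡ (a ℕ.+ a) ℕ.+ (m ℕ.+ m) ℕ.* i
      double = ℕS.solve-∀
      factor : ∀ i → (1# + - 1# * q ^ (a ℕ.+ m ℕ.* i)) * (1# + 1# * q ^ (a ℕ.+ m ℕ.* i)) ≈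
        1# + - 1# * q ^ ((a ℕ.+ a) ℕ.+ (m ℕ.+ m) ℕ.* i)
      factor i = begin
        (1# + - 1# * x) * (1# + 1# * x)
          ≈⟨ solve 2 (λ ε x → (con 1 :+ ε :* x) :* (con 1 :+ con 1 :* x) :=
               (con 1 :+ ε :* (x :* x)) :+ (ε :+ con 1) :* x) refl _ _ ⟩
        (1# + - 1# * (x * x)) + (- 1# + 1#) * x
          ≈⟨ +-congˡ (trans (*-congʳ (-‿inverseˡ 1#)) (zeroˡ x)) ⟩
        (1# + - 1# * (x * x)) + 0#
          ≈⟨ +-identityʳ _ ⟩
        1# + - 1# * (x * x)
          ≈⟨ +-congˡ (*-congˡ (trans (sym (^-homo-* q (a ℕ.+ m ℕ.* i) (a ℕ.+ m ℕ.* i))) (^-congʳ q (double a m i)))) ⟩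
        1# + - 1# * q ^ ((a ℕ.+ a) ℕ.+ (m ℕ.+ m) ℕ.* i) ∎
        where x = q ^ (a ℕ.+ m ℕ.* i)

    1^n≈1 : ∀ n → 1# ^ n ≈ 1#
    1^n≈1 zero    = refl
    1^n≈1 (suc n) = trans (*-identityˡ _) (1^n≈1 n)

    -1*-1≈1 : - 1# * - 1# ≈ 1#
    -1*-1≈1 = trans (-1*x≈-x (- 1#)) (⁻¹-involutive 1#)

    -- This is ψ(q^(2t)): the doubled exponent avoids halving n(n + 1), and ψ(q²), ψ(q¹⁰) are `ψ 1`,
    -- `ψ 5`.
    ψ : ℕ → Carrier
    ψ t = Σ< M (λ n → q ^ (t ℕ.* (n ℕ.* suc n)))

    ψ-sum : ψ 1 + q * ψ 5 ≈
      Σ< M (λ n → q ^ (1 ℕ.* (n ℕ.* suc n)) + q ^ suc (5 ℕ.* (n ℕ.* suc n)))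
    ψ-sum = trans (+-congˡ (Σ<-*ˡ M q _)) (sym (Σ<-+ M _ _))

    -- The indices n = 2k and n = 2k + 1 of ψ are the indices k and −k − 1 of f(q⁶ᵗ , q²ᵗ).
    ψ-product : ∀ t {{_ : ℕ.NonZero t}} → let s = t ℕ.+ t ; u = s ℕ.+ s in ψ t * O s u ≈ O u u
    ψ-product t@(suc _) = begin
      ψ t * O s u
        ≈⟨ *-congʳ (Σ<-extend f (ℕP.m≤m*n M 2) (λ i M≤i → q^-zero (ℕP.≤-trans M≤i (i≤ i)))) ⟨
      Σ< (M ℕ.* 2) f * O s u
        ≈⟨ *-congʳ (trans (pair M) (jacobi-triple ℕP.≤-refl)) ⟩
      O⁺ (s ℕ.+ u) (u ℕ.+ u) * O⁺ s (u ℕ.+ u) * O (u ℕ.+ u) (u ℕ.+ u) * O s u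
        ≈⟨ solve 4 (λ x y z w → x :* y :* z :* w := (w :* (y :* x)) :* z) refl _ _ _ _ ⟩
      (O s u * (O⁺ s (u ℕ.+ u) * O⁺ (s ℕ.+ u) (u ℕ.+ u))) * O (u ℕ.+ u) (u ℕ.+ u)
        ≈⟨ *-congʳ (*-congˡ (poch-dissect₂ 1# s u)) ⟨
      (O s u * O⁺ s u) * O (u ℕ.+ u) (u ℕ.+ u)
        -- Since s + s = u, the product (q^s;q^u)(-q^s;q^u) is (q^u;q^(2u)), the half of (q^u;q^u)
        -- that the triple product leaves out.
        ≈⟨ *-congʳ (OO⁺ s u) ⟩
      O u (u ℕ.+ u) * O (u ℕ.+ u) (u ℕ.+ u)
        ≈⟨ poch-dissect₂ (- 1#) u u ⟨
      O u u ∎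
      where
      s = t ℕ.+ t
      u = s ℕ.+ s
      f : ℕ → Carrier
      f n = q ^ (t ℕ.* (n ℕ.* suc n))
      i≤ : ∀ i → i ℕ.≤ t ℕ.* (i ℕ.* suc i)
      i≤ i = ℕP.≤-trans (ℕP.m≤m*n i (suc i)) (ℕP.m≤n*m (i ℕ.* suc i) t)
      exponents : ∀ t → let s = t ℕ.+ t ; u = s ℕ.+ s in (s ℕ.+ u) ℕ.+ s ≡ u ℕ.+ u
      exponents = ℕS.solve-∀
      open JacobiTriple 1# (*-identityˡ 1#) u (s ℕ.+ u) s (exponents t)
      even : ∀ k → e (+ k) ≡ t ℕ.* ((k ℕ.* 2) ℕ.* suc (k ℕ.* 2))
      even zero    = ≡.sym (ℕP.*-zeroʳ t)
      even (suc k) = identity t k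
        where
        identity : ∀ t k → let s = t ℕ.+ t ; u = s ℕ.+ s in
          suc k ℕ.* (u ℕ.* k ℕ.+ (s ℕ.+ u)) ≡ t ℕ.* ((suc k ℕ.* 2) ℕ.* suc (suc k ℕ.* 2))
        identity = ℕS.solve-∀
      odd : ∀ t k → let s = t ℕ.+ t ; u = s ℕ.+ s in
        suc k ℕ.* (u ℕ.* k ℕ.+ s) ≡ t ℕ.* (suc (k ℕ.* 2) ℕ.* suc (suc (k ℕ.* 2)))
      odd = ℕS.solve-∀
      unsigned : ∀ k → term k ≈ q ^ e k
      unsigned k = trans (*-congʳ (1^n≈1 ∣ k ∣)) (*-identityˡ _)
      pair : ∀ K → Σ< (K ℕ.* 2) f ≈ Σℤ K term
      pair zero    = refl
      pair (suc K) = trans (+-assoc _ _ _) (+-cong (pair K)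
        (+-cong (trans (^-congʳ q (≡.sym (even K))) (sym (unsigned (+ K))))
                (trans (^-congʳ q (≡.sym (odd t K))) (sym (unsigned -[1+ K ])))))

    -- The product of two theta functions, split by parity

    -- Ramanujan's f(x , y) = Σ x^{k(k+1)/2} y^{k(k−1)/2} at (q⁹,q), (−q⁷,−q³), (−q¹⁶,−q⁴),
    -- (−q⁸,−q¹²), (−q⁶,−q¹⁴) and (−q¹⁸,−q²).
    module F₁ = JacobiTriple 1# (*-identityˡ 1#) 5 9 1 ≡.refl
    module F₂ = JacobiTriple (- 1#) -1*-1≈1 5 7 3 ≡.refl
    module F₃ = JacobiTriple (- 1#) -1*-1≈1 10 16 4 ≡.refl
    module F₄ = JacobiTriple (- 1#) -1*-1≈1 10 8 12 ≡.refl
    module F₅ = JacobiTriple (- 1#) -1*-1≈1 10 6 14 ≡.refl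
    module F₆ = JacobiTriple (- 1#) -1*-1≈1 10 18 2 ≡.refl

    -- Only the second factor is signed, and its index is x + y in both parity classes; hence (-1)^n
    -- always splits as (-1)^x (-1)^y.
    term-product : ∀ m n x y → n ≡ x ℤ.+ y → F₁.term m * F₂.term n ≈
      F₃.sgn x * F₄.sgn y * q ^ (F₁.e m ℕ.+ F₂.e n)
    term-product m n x y ≡.refl = begin
      F₁.sgn m * q ^ F₁.e m * (F₂.sgn n * q ^ F₂.e n)
        ≈⟨ *-cong (*-congʳ (1^n≈1 ∣ m ∣)) (*-congʳ (F₂.sgn-+ x y)) ⟩
      1# * q ^ F₁.e m * (F₃.sgn x * F₄.sgn y * q ^ F₂.e n)
        ≈⟨ solve 4 (λ a s t b → con 1 :* a :* (s :* t :* b) := s :* t :* (a :* b)) refl _ _ _ _ ⟩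
      F₃.sgn x * F₄.sgn y * (q ^ F₁.e m * q ^ F₂.e n)
        ≈⟨ *-congˡ (^-homo-* q (F₁.e m) (F₂.e n)) ⟨
      F₃.sgn x * F₄.sgn y * q ^ (F₁.e m ℕ.+ F₂.e n) ∎

    -- The linear part 4m + 2n becomes 6x - 2y; these are the values of a - h, and with h = 10 they
    -- give the pairs (16, 4) and (8, 12).
    even-exponent : ∀ x y → F₁.e (x ℤ.- y) ℕ.+ F₂.e (x ℤ.+ y) ≡ F₃.e x ℕ.+ F₄.e y
    even-exponent x y = ℤP.+-injective (≡.trans
      (≡.cong₂ ℤ._+_ (thetaExp-spec 5 9 1 ≡.refl (x ℤ.- y)) (thetaExp-spec 5 7 3 ≡.refl (x ℤ.+ y)))
      (≡.trans (identity x y)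
        (≡.sym (≡.cong₂ ℤ._+_ (thetaExp-spec 10 16 4 ≡.refl x) (thetaExp-spec 10 8 12 ≡.refl y)))))
      where
      identity : ∀ x y →
        (+ 5 ℤ.* (x ℤ.- y) ℤ.* (x ℤ.- y) ℤ.+ (+ 4) ℤ.* (x ℤ.- y)) ℤ.+
        (+ 5 ℤ.* (x ℤ.+ y) ℤ.* (x ℤ.+ y) ℤ.+ (+ 2) ℤ.* (x ℤ.+ y)) ≡
        (+ 10 ℤ.* x ℤ.* x ℤ.+ + 6 ℤ.* x) ℤ.+ (+ 10 ℤ.* y ℤ.* y ℤ.+ -[1+ 1 ] ℤ.* y)
      identity = solve-∀

    -- Replacing m by x - y - 1 makes the linear part -4x + 8y, whence the pairs (6, 14) and (18,
    -- 2), and leaves the constant 5 - 4 = 1, the extra factor q.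
    odd-exponent : ∀ x y → F₁.e (x ℤ.- y ℤ.- + 1) ℕ.+ F₂.e (x ℤ.+ y) ≡ suc (F₅.e x ℕ.+ F₆.e y)
    odd-exponent x y = ℤP.+-injective (≡.trans
      (≡.cong₂ ℤ._+_ (thetaExp-spec 5 9 1 ≡.refl (x ℤ.- y ℤ.- + 1)) (thetaExp-spec 5 7 3 ≡.refl (x ℤ.+ y)))
      (≡.trans (identity x y)
        (≡.sym (≡.cong₂ (λ a b → + 1 ℤ.+ (a ℤ.+ b)) (thetaExp-spec 10 6 14 ≡.refl x) (thetaExp-spec 10 18 2 ≡.refl y)))))
      where
      identity : ∀ x y →
        (+ 5 ℤ.* (x ℤ.- y ℤ.- + 1) ℤ.* (x ℤ.- y ℤ.- + 1) ℤ.+ (+ 4) ℤ.* (x ℤ.- y ℤ.- + 1)) ℤ.+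
        (+ 5 ℤ.* (x ℤ.+ y) ℤ.* (x ℤ.+ y) ℤ.+ (+ 2) ℤ.* (x ℤ.+ y)) ≡
        + 1 ℤ.+ ((+ 10 ℤ.* x ℤ.* x ℤ.+ -[1+ 3 ] ℤ.* x) ℤ.+ (+ 10 ℤ.* y ℤ.* y ℤ.+ + 8 ℤ.* y))
      identity = solve-∀

    theta-product :
      (O⁺ 9 10 * O⁺ 1 10 * O 10 10) * (O 7 10 * O 3 10 * O 10 10) ≈
        (O 16 20 * O 4 20 * O 20 20) * (O 8 20 * O 12 20 * O 20 20)
          + q * ((O 6 20 * O 14 20 * O 20 20) * (O 18 20 * O 2 20 * O 20 20))
    theta-product = begin
      (O⁺ 9 10 * O⁺ 1 10 * O 10 10) * (O 7 10 * O 3 10 * O 10 10)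
        -- The triple product holds on every window of size at least M, so the two sums can be taken
        -- on the unequal windows required by `Σℤ-rotate`.
        ≈⟨ *-cong (F₁.jacobi-triple M≤K) (F₂.jacobi-triple (ℕP.≤-trans M≤L (ℕP.m≤m*n L 2))) ⟨
      Σℤ K F₁.term * Σℤ (L ℕ.* 2) F₂.term
        ≈⟨ Σℤ-* K (L ℕ.* 2) F₁.term F₂.term ⟩
      Σℤ K (λ m → Σℤ (L ℕ.* 2) (λ n → F₁.term m * F₂.term n))
        ≈⟨ Σℤ-rotate M (λ m n → F₁.term m * F₂.term n)
             (λ n m le → trans (*-congʳ (F₁.term-vanishes m le)) (zeroˡ _))
             (λ m n le → trans (*-congˡ (F₂.term-vanishes n le)) (zeroʳ _)) ⟩
      Σℤ L (λ y → Σℤ K (λ x → F₁.term (x ℤ.- y) * F₂.term (x ℤ.+ y)))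
        + Σℤ L (λ y → Σℤ K (λ x → F₁.term (x ℤ.- y ℤ.- + 1) * F₂.term (x ℤ.+ y)))
        ≈⟨ +-cong (Σℤ-cong L (λ y _ → Σℤ-cong K (λ x _ → even x y)))
                  (Σℤ-cong L (λ y _ → trans (Σℤ-cong K (λ x _ → odd x y)) (sym (Σℤ-*ˡ K q _)))) ⟩
      Σℤ L (λ y → Σℤ K (λ x → F₃.term x * F₄.term y)) + Σℤ L (λ y → q * Σℤ K (λ x → F₅.term x * F₆.term y))
        ≈⟨ +-cong (Σℤ-swap K L _) (trans (*-congˡ (Σℤ-swap K L _)) (Σℤ-*ˡ L q _)) ⟨
      Σℤ K (λ x → Σℤ L (λ y → F₃.term x * F₄.term y)) + q * Σℤ K (λ x → Σℤ L (λ y → F₅.term x * F₆.term y))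
        ≈⟨ +-cong (Σℤ-* K L F₃.term F₄.term) (*-congˡ (Σℤ-* K L F₅.term F₆.term)) ⟨
      Σℤ K F₃.term * Σℤ L F₄.term + q * (Σℤ K F₅.term * Σℤ L F₆.term)
        ≈⟨ +-cong (*-cong (F₃.jacobi-triple M≤K) (F₄.jacobi-triple M≤L))
                  (*-congˡ (*-cong (F₅.jacobi-triple M≤K) (F₆.jacobi-triple M≤L))) ⟩
      (O 16 20 * O 4 20 * O 20 20) * (O 8 20 * O 12 20 * O 20 20)
        + q * ((O 6 20 * O 14 20 * O 20 20) * (O 18 20 * O 2 20 * O 20 20)) ∎
      where
      K = M ℕ.+ (M ℕ.* 2 ℕ.+ 1 ℕ.+ 1)
      L = M ℕ.* 2 ℕ.+ 1
      M≤K : M ℕ.≤ K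
      M≤K = ℕP.m≤m+n M _
      M≤L : M ℕ.≤ L
      M≤L = ℕP.≤-trans (ℕP.m≤m*n M 2) (ℕP.m≤m+n _ 1)
      split : ∀ s t i j → s * t * q ^ (i ℕ.+ j) ≈ (s * q ^ i) * (t * q ^ j)
      split s t i j = trans (*-congˡ (^-homo-* q i j))
        (solve 4 (λ s t x y → s :* t :* (x :* y) := (s :* x) :* (t :* y)) refl _ _ _ _)
      even : ∀ x y → F₁.term (x ℤ.- y) * F₂.term (x ℤ.+ y) ≈ F₃.term x * F₄.term y
      even x y = begin
        F₁.term (x ℤ.- y) * F₂.term (x ℤ.+ y)
          ≈⟨ term-product (x ℤ.- y) (x ℤ.+ y) x y ≡.refl ⟩
        F₃.sgn x * F₄.sgn y * q ^ (F₁.e (x ℤ.- y) ℕ.+ F₂.e (x ℤ.+ y))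
          ≈⟨ *-congˡ (^-congʳ q (even-exponent x y)) ⟩
        F₃.sgn x * F₄.sgn y * q ^ (F₃.e x ℕ.+ F₄.e y)
          ≈⟨ split (F₃.sgn x) (F₄.sgn y) (F₃.e x) (F₄.e y) ⟩
        F₃.term x * F₄.term y ∎
      odd : ∀ x y → F₁.term (x ℤ.- y ℤ.- + 1) * F₂.term (x ℤ.+ y) ≈ q * (F₅.term x * F₆.term y)
      odd x y = begin
        F₁.term (x ℤ.- y ℤ.- + 1) * F₂.term (x ℤ.+ y)
          ≈⟨ term-product (x ℤ.- y ℤ.- + 1) (x ℤ.+ y) x y ≡.refl ⟩
        F₃.sgn x * F₄.sgn y * q ^ (F₁.e (x ℤ.- y ℤ.- + 1) ℕ.+ F₂.e (x ℤ.+ y))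
          ≈⟨ *-congˡ (^-congʳ q (odd-exponent x y)) ⟩
        F₃.sgn x * F₄.sgn y * (q * q ^ (F₅.e x ℕ.+ F₆.e y))
          ≈⟨ solve 3 (λ s q x → s :* (q :* x) := q :* (s :* x)) refl _ _ _ ⟩
        q * (F₃.sgn x * F₄.sgn y * q ^ (F₅.e x ℕ.+ F₆.e y))
          ≈⟨ *-congˡ (split (F₅.sgn x) (F₆.sgn y) (F₅.e x) (F₆.e y)) ⟩
        q * (F₅.term x * F₆.term y) ∎

    -- The product formula for ψ(q²) + q ψ(q¹⁰)

    cancel-unit : ∀ {u u⁻¹ x y} → u * u⁻¹ ≈ 1# → x * u ≈ y * u → x ≈ y
    cancel-unit {u} {u⁻¹} {x} {y} uu⁻¹≈1 xu≈yu = begin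
      x               ≈⟨ *-identityʳ x ⟨
      x * 1#          ≈⟨ *-congˡ uu⁻¹≈1 ⟨
      x * (u * u⁻¹)   ≈⟨ *-assoc _ _ _ ⟨
      x * u * u⁻¹     ≈⟨ *-congʳ xu≈yu ⟩
      y * u * u⁻¹     ≈⟨ *-assoc _ _ _ ⟩
      y * (u * u⁻¹)   ≈⟨ *-congˡ uu⁻¹≈1 ⟩
      y * 1#          ≈⟨ *-identityʳ y ⟩
      y               ∎

    -- Both sides are multiplied by the unit `D`: its factor (q,q⁴;q⁵) clears the denominator, and
    -- (-q,-q⁹,q¹⁰;q¹⁰) completes (q³,q⁷,q¹⁰;q¹⁰) to the product of two theta functions.
    ψ-sum-product : ψ 1 + q * ψ 5 ≈
      O 3 10 * O 7 10 * O 10 10 * O 4 20 * O 16 20 * O⁻¹ 1 5 * O⁻¹ 4 5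
    ψ-sum-product = cancel-unit D-unit (trans lhs (sym rhs))
      where
      D D⁻¹ common : Carrier
      D = O 1 5 * O 4 5 * O⁺ 1 10 * O⁺ 9 10 * O 10 10
      -- Only factors 1 - q^k have given inverses, so 1/(-q;q¹⁰) is written as (q;q¹⁰)/(q²;q²⁰), and
      -- similarly for q⁹.
      D⁻¹ = O⁻¹ 1 5 * O⁻¹ 4 5 * (O 1 10 * O⁻¹ 2 20) * (O 9 10 * O⁻¹ 18 20) * O⁻¹ 10 10
      common = ((O 16 20 * O 4 20 * O 20 20) * (O 8 20 * O 12 20 * O 20 20)
        + q * ((O 6 20 * O 14 20 * O 20 20) * (O 18 20 * O 2 20 * O 20 20))) * (O 4 20 * O 16 20)

      D-unit : D * D⁻¹ ≈ 1#
      D-unit = begin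
        D * D⁻¹
          ≈⟨ solve 12 (λ a b c d e a′ b′ p c′ r d′ e′ →
               (a :* b :* c :* d :* e) :* (a′ :* b′ :* (p :* c′) :* (r :* d′) :* e′) :=
               (a :* a′) :* (b :* b′) :* ((p :* c) :* c′) :* ((r :* d) :* d′) :* (e :* e′))
               refl _ _ _ _ _ _ _ _ _ _ _ _ ⟩
        (O 1 5 * O⁻¹ 1 5) * (O 4 5 * O⁻¹ 4 5) * ((O 1 10 * O⁺ 1 10) * O⁻¹ 2 20)
          * ((O 9 10 * O⁺ 9 10) * O⁻¹ 18 20) * (O 10 10 * O⁻¹ 10 10)
          ≈⟨ *-cong (*-cong (*-cong (*-cong (OO⁻¹≈1 0 5) (OO⁻¹≈1 3 5))
               (trans (*-congʳ (OO⁺ 1 10)) (OO⁻¹≈1 1 20)))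
               (trans (*-congʳ (OO⁺ 9 10)) (OO⁻¹≈1 17 20))) (OO⁻¹≈1 9 10) ⟩
        1# * 1# * 1# * 1# * 1#
          ≈⟨ solve 0 (con 1 :* con 1 :* con 1 :* con 1 :* con 1 := con 1) refl ⟩
        1# ∎

      D-expand : D ≈ (O 2 20 * O 18 20 * O 6 20 * O 14 20) * (O 4 20 * O 16 20) * (O 10 20 * O 20 20)
      D-expand = begin
        O 1 5 * O 4 5 * O⁺ 1 10 * O⁺ 9 10 * O 10 10
          -- The products in base q⁵ supply (q,q⁹;q¹⁰), which the plus-sign factors square to
          -- (q²,q¹⁸;q²⁰); the leftover (q⁶,q¹⁴;q²⁰) completes W.
          ≈⟨ *-cong (*-congʳ (*-congʳ (*-cong
               (trans (poch-dissect₂ (- 1#) 1 5) (*-congˡ (poch-dissect₂ (- 1#) 6 10)))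
               (trans (poch-dissect₂ (- 1#) 4 5) (*-congʳ (poch-dissect₂ (- 1#) 4 10))))))
               (poch-dissect₂ (- 1#) 10 10) ⟩
        O 1 10 * (O 6 20 * O 16 20) * (O 4 20 * O 14 20 * O 9 10) * O⁺ 1 10 * O⁺ 9 10 * (O 10 20 * O 20 20)
          ≈⟨ solve 9 (λ p₁ o₆ o₁₆ o₄ o₁₄ p₉ m₁ m₉ e →
               p₁ :* (o₆ :* o₁₆) :* (o₄ :* o₁₄ :* p₉) :* m₁ :* m₉ :* e :=
               ((p₁ :* m₁) :* (p₉ :* m₉) :* o₆ :* o₁₄) :* (o₄ :* o₁₆) :* e) refl _ _ _ _ _ _ _ _ _ ⟩
        ((O 1 10 * O⁺ 1 10) * (O 9 10 * O⁺ 9 10) * O 6 20 * O 14 20) * (O 4 20 * O 16 20) * (O 10 20 * O 20 20)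
          ≈⟨ *-congʳ (*-congʳ (*-congʳ (*-congʳ (*-cong (OO⁺ 1 10) (OO⁺ 9 10))))) ⟩
        (O 2 20 * O 18 20 * O 6 20 * O 14 20) * (O 4 20 * O 16 20) * (O 10 20 * O 20 20) ∎

      lhs : (ψ 1 + q * ψ 5) * D ≈ common
      lhs = begin
        (ψ 1 + q * ψ 5) * D
          ≈⟨ *-congˡ D-expand ⟩
        (ψ 1 + q * ψ 5) * ((O 2 20 * O 18 20 * O 6 20 * O 14 20) * (O 4 20 * O 16 20) * (O 10 20 * O 20 20))
          ≈⟨ solve 10 (λ x y q o₂ o₁₈ o₆ o₁₄ z o₁₀ e →
               (x :+ q :* y) :* ((o₂ :* o₁₈ :* o₆ :* o₁₄) :* z :* (o₁₀ :* e)) :=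
               ((x :* (o₂ :* o₆ :* o₁₀ :* o₁₄ :* o₁₈)) :* e :+ q :* ((y :* o₁₀) :* (o₂ :* o₁₈ :* o₆ :* o₁₄) :* e)) :* z)
               refl _ _ _ _ _ _ _ _ _ _ ⟩
        ((ψ 1 * (O 2 20 * O 6 20 * O 10 20 * O 14 20 * O 18 20)) * O 20 20
          + q * ((ψ 5 * O 10 20) * (O 2 20 * O 18 20 * O 6 20 * O 14 20) * O 20 20)) * (O 4 20 * O 16 20)
          -- W together with (q¹⁰;q²⁰) is (q²;q⁴), the factor that `ψ-product 1` absorbs; (q¹⁰;q²⁰)
          -- alone is the one that `ψ-product 5` absorbs.
          ≈⟨ *-congʳ (+-cong
               (*-congʳ (trans (*-congˡ (sym (poch-dissect₅ (- 1#) 2 4)))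
                 (trans (ψ-product 1) (poch-dissect₅ (- 1#) 4 4))))
               (*-congˡ (*-congʳ (*-congʳ (ψ-product 5))))) ⟩
        ((O 4 20 * O 8 20 * O 12 20 * O 16 20 * O 20 20) * O 20 20
          + q * (O 20 20 * (O 2 20 * O 18 20 * O 6 20 * O 14 20) * O 20 20)) * (O 4 20 * O 16 20)
          ≈⟨ *-congʳ (+-cong
               (solve 5 (λ a b c d e → (a :* b :* c :* d :* e) :* e := (d :* a :* e) :* (b :* c :* e)) refl _ _ _ _ _)
               (*-congˡ (solve 5 (λ e a b c d → e :* (a :* b :* c :* d) :* e := (c :* d :* e) :* (b :* a :* e)) refl _ _ _ _ _))) ⟩
        common ∎

      rhs : O 3 10 * O 7 10 * O 10 10 * O 4 20 * O 16 20 * O⁻¹ 1 5 * O⁻¹ 4 5 * D ≈ common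
      rhs = begin
        O 3 10 * O 7 10 * O 10 10 * O 4 20 * O 16 20 * O⁻¹ 1 5 * O⁻¹ 4 5 * (O 1 5 * O 4 5 * O⁺ 1 10 * O⁺ 9 10 * O 10 10)
          ≈⟨ solve 11 (λ o₃ o₇ e o₄ o₁₆ i₁ i₄ j₁ j₄ m₁ m₉ →
               o₃ :* o₇ :* e :* o₄ :* o₁₆ :* i₁ :* i₄ :* (j₁ :* j₄ :* m₁ :* m₉ :* e) :=
               (j₁ :* i₁) :* ((j₄ :* i₄) :* (((m₉ :* m₁ :* e) :* (o₇ :* o₃ :* e)) :* (o₄ :* o₁₆))))
               refl _ _ _ _ _ _ _ _ _ _ _ ⟩
        (O 1 5 * O⁻¹ 1 5) * ((O 4 5 * O⁻¹ 4 5) *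
          (((O⁺ 9 10 * O⁺ 1 10 * O 10 10) * (O 7 10 * O 3 10 * O 10 10)) * (O 4 20 * O 16 20)))
          ≈⟨ *-cong (OO⁻¹≈1 0 5) (*-cong (OO⁻¹≈1 3 5) (*-congʳ theta-product)) ⟩
        1# * (1# * common)
          ≈⟨ trans (*-identityˡ _) (*-identityˡ _) ⟩
        common ∎

-- Power series modulo q^M

⊛-zero : ∀ f g → (f ⊛ g) 0 ≡ f 0 ℤ.* g 0
⊛-zero f g = ℤP.+-identityʳ _

-- Peeling off the constant term of `f` lets the ring laws be proved by induction on the degree, for
-- all series at once, without re-indexing double sums.
⊛-suc : ∀ f g n → (f ⊛ g) (suc n) ≡ f 0 ℤ.* g (suc n) ℤ.+ ((f ∘ suc) ⊛ g) n
⊛-suc f g n = ≡.trans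
  (≡.cong sumℤ (map-upTo (λ i → f i ℤ.* g (suc n ℕ.∸ i)) (suc (suc n))))
  (≡.cong (λ s → f 0 ℤ.* g (suc n) ℤ.+ sumℤ s)
    (≡.sym (map-upTo (λ i → f (suc i) ℤ.* g (n ℕ.∸ i)) (suc n))))

-- This makes multiplication well defined modulo q^M, and it allows a factor to be rewritten
-- pointwise.
⊛-local : ∀ n {f f′ g g′ : PS} → (∀ i → i ℕ.≤ n → f i ≡ f′ i) → (∀ i → i ℕ.≤ n → g i ≡ g′ i) →
  (f ⊛ g) n ≡ (f′ ⊛ g′) n
⊛-local zero    {f} {f′} {g} {g′} p r = ≡.trans (⊛-zero f g)
  (≡.trans (≡.cong₂ ℤ._*_ (p 0 ℕ.z≤n) (r 0 ℕ.z≤n)) (≡.sym (⊛-zero f′ g′)))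
⊛-local (suc n) {f} {f′} {g} {g′} p r = ≡.trans (⊛-suc f g n) (≡.trans
  (≡.cong₂ ℤ._+_ (≡.cong₂ ℤ._*_ (p 0 ℕ.z≤n) (r (suc n) ℕP.≤-refl))
    (⊛-local n (λ i le → p (suc i) (ℕ.s≤s le)) (λ i le → r i (ℕP.m≤n⇒m≤1+n le))))
  (≡.sym (⊛-suc f′ g′ n)))

⊛-distribʳ : ∀ n (h f g : PS) → ((λ i → f i ℤ.+ g i) ⊛ h) n ≡ (f ⊛ h) n ℤ.+ (g ⊛ h) n
⊛-distribʳ zero h f g = begin
  ((λ i → f i ℤ.+ g i) ⊛ h) 0              ≡⟨ ⊛-zero (λ i → f i ℤ.+ g i) h ⟩
  (f 0 ℤ.+ g 0) ℤ.* h 0                    ≡⟨ ℤP.*-distribʳ-+ (h 0) (f 0) (g 0) ⟩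
  f 0 ℤ.* h 0 ℤ.+ g 0 ℤ.* h 0              ≡⟨ ≡.cong₂ ℤ._+_ (⊛-zero f h) (⊛-zero g h) ⟨
  (f ⊛ h) 0 ℤ.+ (g ⊛ h) 0                  ∎
  where open ≡.≡-Reasoning
⊛-distribʳ (suc n) h f g = begin
  ((λ i → f i ℤ.+ g i) ⊛ h) (suc n)
    ≡⟨ ⊛-suc (λ i → f i ℤ.+ g i) h n ⟩
  (f 0 ℤ.+ g 0) ℤ.* h (suc n) ℤ.+ ((λ i → f (suc i) ℤ.+ g (suc i)) ⊛ h) n
    ≡⟨ ≡.cong (ℤ._+_ ((f 0 ℤ.+ g 0) ℤ.* h (suc n))) (⊛-distribʳ n h (f ∘ suc) (g ∘ suc)) ⟩
  (f 0 ℤ.+ g 0) ℤ.* h (suc n) ℤ.+ (((f ∘ suc) ⊛ h) n ℤ.+ ((g ∘ suc) ⊛ h) n)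
    ≡⟨ regroup (f 0) (g 0) (h (suc n)) (((f ∘ suc) ⊛ h) n) (((g ∘ suc) ⊛ h) n) ⟩
  (f 0 ℤ.* h (suc n) ℤ.+ ((f ∘ suc) ⊛ h) n) ℤ.+ (g 0 ℤ.* h (suc n) ℤ.+ ((g ∘ suc) ⊛ h) n)
    ≡⟨ ≡.cong₂ ℤ._+_ (⊛-suc f h n) (⊛-suc g h n) ⟨
  (f ⊛ h) (suc n) ℤ.+ (g ⊛ h) (suc n) ∎
  where
  open ≡.≡-Reasoning
  regroup : ∀ a b c x y → (a ℤ.+ b) ℤ.* c ℤ.+ (x ℤ.+ y) ≡ (a ℤ.* c ℤ.+ x) ℤ.+ (b ℤ.* c ℤ.+ y)
  regroup = solve-∀

⊛-scale : ∀ n c (f g : PS) → ((λ i → c ℤ.* f i) ⊛ g) n ≡ c ℤ.* (f ⊛ g) n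
⊛-scale zero    c f g = ≡.trans (⊛-zero (λ i → c ℤ.* f i) g)
  (≡.trans (ℤP.*-assoc c (f 0) (g 0)) (≡.cong (c ℤ.*_) (≡.sym (⊛-zero f g))))
⊛-scale (suc n) c f g = begin
  ((λ i → c ℤ.* f i) ⊛ g) (suc n)
    ≡⟨ ⊛-suc (λ i → c ℤ.* f i) g n ⟩
  c ℤ.* f 0 ℤ.* g (suc n) ℤ.+ ((λ i → c ℤ.* f (suc i)) ⊛ g) n
    ≡⟨ ≡.cong₂ ℤ._+_ (ℤP.*-assoc c (f 0) (g (suc n))) (⊛-scale n c (f ∘ suc) g) ⟩
  c ℤ.* (f 0 ℤ.* g (suc n)) ℤ.+ c ℤ.* ((f ∘ suc) ⊛ g) n
    ≡⟨ ℤP.*-distribˡ-+ c (f 0 ℤ.* g (suc n)) (((f ∘ suc) ⊛ g) n) ⟨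
  c ℤ.* (f 0 ℤ.* g (suc n) ℤ.+ ((f ∘ suc) ⊛ g) n)
    ≡⟨ ≡.cong (c ℤ.*_) (⊛-suc f g n) ⟨
  c ℤ.* (f ⊛ g) (suc n) ∎
  where open ≡.≡-Reasoning

⊛-zeroˡ : ∀ n (g : PS) → ((λ _ → + 0) ⊛ g) n ≡ + 0
⊛-zeroˡ n g = ≡.trans (⊛-scale n (+ 0) (λ _ → + 0) g) (ℤP.*-zeroˡ (((λ _ → + 0) ⊛ g) n))

⊛-identityˡ : ∀ n (g : PS) → (one ⊛ g) n ≡ g n
⊛-identityˡ zero    g = ≡.trans (⊛-zero one g) (ℤP.*-identityˡ (g 0))
⊛-identityˡ (suc n) g = ≡.trans (⊛-suc one g n)
  (≡.trans (≡.cong₂ ℤ._+_ (ℤP.*-identityˡ (g (suc n))) (⊛-zeroˡ n g)) (ℤP.+-identityʳ (g (suc n))))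

-- The mirror image of `⊛-suc`; commutativity is the meeting of the two recursions.
⊛-sucʳ : ∀ n (f g : PS) → (f ⊛ g) (suc n) ≡ f (suc n) ℤ.* g 0 ℤ.+ (f ⊛ (g ∘ suc)) n
⊛-sucʳ zero f g = begin
  (f ⊛ g) 1                                            ≡⟨ ⊛-suc f g 0 ⟩
  f 0 ℤ.* g 1 ℤ.+ ((f ∘ suc) ⊛ g) 0                    ≡⟨ ≡.cong (ℤ._+_ (f 0 ℤ.* g 1)) (⊛-zero (f ∘ suc) g) ⟩
  f 0 ℤ.* g 1 ℤ.+ f 1 ℤ.* g 0                          ≡⟨ ℤP.+-comm (f 0 ℤ.* g 1) (f 1 ℤ.* g 0) ⟩
  f 1 ℤ.* g 0 ℤ.+ f 0 ℤ.* g 1                          ≡⟨ ≡.cong (ℤ._+_ (f 1 ℤ.* g 0)) (⊛-zero f (g ∘ suc)) ⟨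
  f 1 ℤ.* g 0 ℤ.+ (f ⊛ (g ∘ suc)) 0                    ∎
  where open ≡.≡-Reasoning
⊛-sucʳ (suc n) f g = begin
  (f ⊛ g) (suc (suc n))
    ≡⟨ ⊛-suc f g (suc n) ⟩
  f 0 ℤ.* g (suc (suc n)) ℤ.+ ((f ∘ suc) ⊛ g) (suc n)
    ≡⟨ ≡.cong (ℤ._+_ (f 0 ℤ.* g (suc (suc n)))) (⊛-sucʳ n (f ∘ suc) g) ⟩
  f 0 ℤ.* g (suc (suc n)) ℤ.+ (f (suc (suc n)) ℤ.* g 0 ℤ.+ ((f ∘ suc) ⊛ (g ∘ suc)) n)
    ≡⟨ swap (f 0 ℤ.* g (suc (suc n))) (f (suc (suc n)) ℤ.* g 0) (((f ∘ suc) ⊛ (g ∘ suc)) n) ⟩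
  f (suc (suc n)) ℤ.* g 0 ℤ.+ (f 0 ℤ.* g (suc (suc n)) ℤ.+ ((f ∘ suc) ⊛ (g ∘ suc)) n)
    ≡⟨ ≡.cong (ℤ._+_ (f (suc (suc n)) ℤ.* g 0)) (⊛-suc f (g ∘ suc) n) ⟨
  f (suc (suc n)) ℤ.* g 0 ℤ.+ (f ⊛ (g ∘ suc)) (suc n) ∎
  where
  open ≡.≡-Reasoning
  swap : ∀ x y z → x ℤ.+ (y ℤ.+ z) ≡ y ℤ.+ (x ℤ.+ z)
  swap = solve-∀

⊛-comm : ∀ n (f g : PS) → (f ⊛ g) n ≡ (g ⊛ f) n
⊛-comm zero    f g = ≡.trans (⊛-zero f g) (≡.trans (ℤP.*-comm (f 0) (g 0)) (≡.sym (⊛-zero g f)))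
⊛-comm (suc n) f g = begin
  (f ⊛ g) (suc n)                                     ≡⟨ ⊛-suc f g n ⟩
  f 0 ℤ.* g (suc n) ℤ.+ ((f ∘ suc) ⊛ g) n             ≡⟨ ≡.cong₂ ℤ._+_ (ℤP.*-comm (f 0) (g (suc n))) (⊛-comm n (f ∘ suc) g) ⟩
  g (suc n) ℤ.* f 0 ℤ.+ (g ⊛ (f ∘ suc)) n             ≡⟨ ⊛-sucʳ n g f ⟨
  (g ⊛ f) (suc n)                                     ∎
  where open ≡.≡-Reasoning

⊛-assoc : ∀ n (f g h : PS) → ((f ⊛ g) ⊛ h) n ≡ (f ⊛ (g ⊛ h)) n
⊛-assoc zero f g h = begin
  ((f ⊛ g) ⊛ h) 0              ≡⟨ ⊛-zero (f ⊛ g) h ⟩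
  (f ⊛ g) 0 ℤ.* h 0            ≡⟨ ≡.cong (ℤ._* h 0) (⊛-zero f g) ⟩
  f 0 ℤ.* g 0 ℤ.* h 0          ≡⟨ ℤP.*-assoc (f 0) (g 0) (h 0) ⟩
  f 0 ℤ.* (g 0 ℤ.* h 0)        ≡⟨ ≡.cong (f 0 ℤ.*_) (⊛-zero g h) ⟨
  f 0 ℤ.* (g ⊛ h) 0            ≡⟨ ⊛-zero f (g ⊛ h) ⟨
  (f ⊛ (g ⊛ h)) 0              ∎
  where open ≡.≡-Reasoning
⊛-assoc (suc n) f g h = begin
  ((f ⊛ g) ⊛ h) (suc n)
    ≡⟨ ⊛-suc (f ⊛ g) h n ⟩
  (f ⊛ g) 0 ℤ.* h (suc n) ℤ.+ (((f ⊛ g) ∘ suc) ⊛ h) n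
    ≡⟨ ≡.cong₂ ℤ._+_ (≡.cong (ℤ._* h (suc n)) (⊛-zero f g))
         (⊛-local n {g = h} (λ i _ → ⊛-suc f g i) (λ _ _ → ≡.refl)) ⟩
  f 0 ℤ.* g 0 ℤ.* h (suc n) ℤ.+ ((λ i → f 0 ℤ.* g (suc i) ℤ.+ ((f ∘ suc) ⊛ g) i) ⊛ h) n
    ≡⟨ ≡.cong (ℤ._+_ (f 0 ℤ.* g 0 ℤ.* h (suc n)))
         (≡.trans (⊛-distribʳ n h (λ i → f 0 ℤ.* g (suc i)) ((f ∘ suc) ⊛ g))
           (≡.cong₂ ℤ._+_ (⊛-scale n (f 0) (g ∘ suc) h) (⊛-assoc n (f ∘ suc) g h))) ⟩
  f 0 ℤ.* g 0 ℤ.* h (suc n) ℤ.+ (f 0 ℤ.* ((g ∘ suc) ⊛ h) n ℤ.+ ((f ∘ suc) ⊛ (g ⊛ h)) n)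
    ≡⟨ factor (f 0) (g 0) (h (suc n)) (((g ∘ suc) ⊛ h) n) (((f ∘ suc) ⊛ (g ⊛ h)) n) ⟩
  f 0 ℤ.* (g 0 ℤ.* h (suc n) ℤ.+ ((g ∘ suc) ⊛ h) n) ℤ.+ ((f ∘ suc) ⊛ (g ⊛ h)) n
    ≡⟨ ≡.cong (λ z → f 0 ℤ.* z ℤ.+ ((f ∘ suc) ⊛ (g ⊛ h)) n) (⊛-suc g h n) ⟨
  f 0 ℤ.* (g ⊛ h) (suc n) ℤ.+ ((f ∘ suc) ⊛ (g ⊛ h)) n
    ≡⟨ ⊛-suc f (g ⊛ h) n ⟨
  (f ⊛ (g ⊛ h)) (suc n) ∎
  where
  open ≡.≡-Reasoning
  factor : ∀ a b c x y → a ℤ.* b ℤ.* c ℤ.+ (a ℤ.* x ℤ.+ y) ≡ a ℤ.* (b ℤ.* c ℤ.+ x) ℤ.+ y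
  factor = solve-∀

⊛-distribˡ : ∀ n (h f g : PS) → (h ⊛ (λ i → f i ℤ.+ g i)) n ≡ (h ⊛ f) n ℤ.+ (h ⊛ g) n
⊛-distribˡ n h f g = ≡.trans (⊛-comm n h (λ i → f i ℤ.+ g i)) (≡.trans (⊛-distribʳ n h f g)
  (≡.cong₂ ℤ._+_ (⊛-comm n f h) (⊛-comm n g h)))

-- The quotient ring and its nilpotent element q

record AgreeBelow (M : ℕ) (f g : PS) : Set where
  constructor agree
  field coefficient : ∀ n → n ℕ.< M → f n ≡ g n

open AgreeBelow

-- ℤ[[q]] / (q^M), with series themselves as representatives.
truncatedRing : ℕ → CommutativeRing 0ℓ 0ℓ
truncatedRing M = record
  { Carrier = PS
  ; _≈_ = AgreeBelow M
  ; _+_ = λ f g n → f n ℤ.+ g n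
  ; _*_ = _⊛_
  ; -_ = λ f n → ℤ.- f n
  ; 0# = λ _ → + 0
  ; 1# = one
  ; isCommutativeRing = record
    { isRing = record
      { +-isAbelianGroup = record
        { isGroup = record
          { isMonoid = record
            { isSemigroup = record
              { isMagma = record
                { isEquivalence = record
                  { refl = agree λ n _ → ≡.refl
                  ; sym = λ p → agree λ n lt → ≡.sym (coefficient p n lt)
                  ; trans = λ p r → agree λ n lt → ≡.trans (coefficient p n lt) (coefficient r n lt) }
                ; ∙-cong = λ p r → agree λ n lt → ≡.cong₂ ℤ._+_ (coefficient p n lt) (coefficient r n lt) }
              ; assoc = λ f g h → agree λ n _ → ℤP.+-assoc (f n) (g n) (h n) }
            ; identity = (λ f → agree λ n _ → ℤP.+-identityˡ (f n)) , (λ f → agree λ n _ → ℤP.+-identityʳ (f n)) }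
          ; inverse = (λ f → agree λ n _ → ℤP.+-inverseˡ (f n)) , (λ f → agree λ n _ → ℤP.+-inverseʳ (f n))
          ; ⁻¹-cong = λ p → agree λ n lt → ≡.cong ℤ.-_ (coefficient p n lt) }
        ; comm = λ f g → agree λ n _ → ℤP.+-comm (f n) (g n) }
      ; *-cong = λ p r → agree λ n lt →
          ⊛-local n (λ i le → coefficient p i (ℕP.≤-<-trans le lt)) (λ i le → coefficient r i (ℕP.≤-<-trans le lt))
      ; *-assoc = λ f g h → agree λ n _ → ⊛-assoc n f g h
      ; *-identity = (λ f → agree λ n _ → ⊛-identityˡ n f) , (λ f → agree λ n _ → ≡.trans (⊛-comm n f one) (⊛-identityˡ n f))
      ; distrib = (λ f g h → agree λ n _ → ⊛-distribˡ n f g h) , (λ f g h → agree λ n _ → ⊛-distribʳ n f g h) }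
    ; *-comm = λ f g → agree λ n _ → ⊛-comm n f g } }

δ0≡one : ∀ n → δ 0 n ≡ one n
δ0≡one zero    = ≡.refl
δ0≡one (suc n) = ≡.refl

-- `δ 1` is the series q, the nilpotent element at which the abstract theory is applied.
δ1-⊛-suc : ∀ f n → (δ 1 ⊛ f) (suc n) ≡ f n
δ1-⊛-suc f n = begin
  (δ 1 ⊛ f) (suc n)                         ≡⟨ ⊛-suc (δ 1) f n ⟩
  + 0 ℤ.* f (suc n) ℤ.+ (δ 0 ⊛ f) n         ≡⟨ ≡.cong₂ ℤ._+_ (ℤP.*-zeroˡ (f (suc n))) (⊛-local n {g = f} (λ i _ → δ0≡one i) (λ _ _ → ≡.refl)) ⟩
  + 0 ℤ.+ (one ⊛ f) n                       ≡⟨ ℤP.+-identityˡ _ ⟩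
  (one ⊛ f) n                               ≡⟨ ⊛-identityˡ n f ⟩
  f n                                       ∎
  where open ≡.≡-Reasoning

module Truncated (M : ℕ) where
  open CommutativeRing (truncatedRing M) public
  open import Algebra.Properties.Semiring.Exp semiring public using (_^_)
  open Bilateral (truncatedRing M) public
  open Nilpotent (truncatedRing M) (δ 1) M public

  q^≡δ : ∀ k n → (δ 1 ^ k) n ≡ δ k n
  q^≡δ zero    n       = ≡.sym (δ0≡one n)
  q^≡δ (suc k) zero    = ⊛-zero (δ 1) (δ 1 ^ k)
  q^≡δ (suc k) (suc n) = ≡.trans (δ1-⊛-suc (δ 1 ^ k) n) (q^≡δ k n)

  q^-⊛-small : ∀ k f n → n ℕ.< k → ((δ 1 ^ k) ⊛ f) n ≡ + 0
  q^-⊛-small (suc k) f zero    _          = ≡.trans (⊛-assoc 0 (δ 1) (δ 1 ^ k) f)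
    (⊛-zero (δ 1) ((δ 1 ^ k) ⊛ f))
  q^-⊛-small (suc k) f (suc n) (ℕ.s≤s lt) = ≡.trans (⊛-assoc (suc n) (δ 1) (δ 1 ^ k) f)
    (≡.trans (δ1-⊛-suc ((δ 1 ^ k) ⊛ f) n) (q^-⊛-small k f n lt))

  q^-⊛-shift : ∀ k f n → ((δ 1 ^ k) ⊛ f) (k ℕ.+ n) ≡ f n
  q^-⊛-shift zero    f n = ⊛-identityˡ n f
  q^-⊛-shift (suc k) f n = ≡.trans (⊛-assoc (suc (k ℕ.+ n)) (δ 1) (δ 1 ^ k) f)
    (≡.trans (δ1-⊛-suc ((δ 1 ^ k) ⊛ f) (k ℕ.+ n)) (q^-⊛-shift k f n))

  q^M≈0 : δ 1 ^ M ≈ 0#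
  q^M≈0 = agree λ n n<M → ≡.trans (≡.sym (≡.trans (⊛-comm n (δ 1 ^ M) one) (⊛-identityˡ n (δ 1 ^ M)))) (q^-⊛-small M one n n<M)

  oneMinusQ≈ : ∀ k → oneMinusQ (suc k) ≈ 1# + - 1# * δ 1 ^ suc k
  oneMinusQ≈ k = trans (agree pointwise) (1-x≈1+[-1]x (δ 1 ^ suc k))
    where
    pointwise : ∀ n → n ℕ.< M → oneMinusQ (suc k) n ≡ one n ℤ.- (δ 1 ^ suc k) n
    pointwise zero    _ = ≡.cong (λ z → + 1 ℤ.- z) (≡.sym (q^≡δ (suc k) 0))
    pointwise (suc n) _ = ≡.trans bit (≡.trans (≡.cong ℤ.-_ (≡.sym (q^≡δ (suc k) (suc n)))) (≡.sym (ℤP.+-identityˡ _)))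
      where
      bit : (if k ℕ.≡ᵇ n then ℤ.- (+ 1) else + 0) ≡ ℤ.- (if k ℕ.≡ᵇ n then + 1 else + 0)
      bit with k ℕ.≡ᵇ n
      ... | true  = ≡.refl
      ... | false = ≡.refl

-- Geometric series as inverses, and independence of the truncation

geomQ-dividing : ∀ {k n} → k ∣ n → geomQ k n ≡ + 1
geomQ-dividing {k} {n} p with k ∣? n
... | yes _ = ≡.refl
... | no ¬p = contradiction p ¬p

geomQ-nondividing : ∀ {k n} → ¬ (k ∣ n) → geomQ k n ≡ + 0
geomQ-nondividing {k} {n} ¬p with k ∣? n
... | yes p = contradiction p ¬p
... | no _  = ≡.refl

geomQ-small : ∀ {k n} → n ℕ.< k → geomQ k n ≡ one n
geomQ-small {k} {zero}  _  = geomQ-dividing (k ∣0)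
geomQ-small {k} {suc n} lt = geomQ-nondividing (>⇒∤ lt)

geomQ-periodic : ∀ k n → geomQ k (k ℕ.+ n) ≡ geomQ k n
geomQ-periodic k n with k ∣? n
... | yes p = geomQ-dividing (∣m∣n⇒∣m+n ∣-refl p)
... | no ¬p = geomQ-nondividing (λ p → ¬p (∣m+n∣m⇒∣n p ∣-refl))

oneMinusQ-small : ∀ {k n} → n ℕ.< k → oneMinusQ k n ≡ one n
oneMinusQ-small {k} {zero}  _  = ≡.refl
oneMinusQ-small {k} {suc n} lt = ≡.cong (if_then ℤ.- (+ 1) else + 0)
  (dec-false (k ℕ.≟ suc n) (λ eq → ℕP.<-irrefl (≡.sym eq) lt))

module Instance (M : ℕ) where
  open Truncated M

  -- Let G be the geometric series. Below degree k + 1 it agrees with 1 and q^(k+1) G has no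
  -- coefficients; from there on the period k + 1 of G makes G - q^(k+1) G vanish.
  geomQ-inverse : ∀ k → (1# + - 1# * δ 1 ^ suc k) * geomQ (suc k) ≈ 1#
  geomQ-inverse k = trans ([1-x]y≈y-xy (δ 1 ^ suc k) (geomQ (suc k))) (agree pointwise)
    where
    pointwise : ∀ n → n ℕ.< M → geomQ (suc k) n ℤ.- (δ 1 ^ suc k * geomQ (suc k)) n ≡ one n
    pointwise n _ with n ℕ.<? suc k
    ... | yes lt = ≡.trans (≡.cong₂ ℤ._-_ (geomQ-small lt) (q^-⊛-small (suc k) (geomQ (suc k)) n lt)) (ℤP.+-identityʳ _)
    ... | no ≥k = ≡.subst (λ n → geomQ (suc k) n ℤ.- (δ 1 ^ suc k * geomQ (suc k)) n ≡ one n)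
      (ℕP.m+[n∸m]≡n (ℕP.≮⇒≥ ≥k))
      (≡.trans (≡.cong₂ ℤ._-_ (geomQ-periodic (suc k) (n ℕ.∸ suc k)) (q^-⊛-shift (suc k) (geomQ (suc k)) (n ℕ.∸ suc k)))
               (ℤP.+-inverseʳ (geomQ (suc k) (n ℕ.∸ suc k))))

  open Laws q^M≈0 geomQ geomQ-inverse public

-- The rings for different M share carrier and operations and differ only in their equality. The
-- equation is therefore one of actual series, and M can be changed through it.
prodUpTo≡Π< : ∀ M n F → prodUpTo n F ≡ Truncated.Π< M n F
prodUpTo≡Π< M zero    F = ≡.refl
prodUpTo≡Π< M (suc n) F = ≡.cong (_⊛ F n) (prodUpTo≡Π< M n F)

-- `qPoch` and `qPochInv` use a product whose length depends on the coefficient read. Modulo q^(n+1)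
-- the factors from i = n + 1 on are 1, so one length M serves all n < M.
prodUpTo-stable : ∀ {M n} F → (∀ i j → j ℕ.≤ i → F i j ≡ one j) → n ℕ.< M →
  prodUpTo (suc n) F n ≡ prodUpTo M F n
prodUpTo-stable {M} {n} F p n<M = ≡.sym (≡.trans (≡.cong (λ f → f n) (prodUpTo≡Π< (suc n) M F))
  (≡.trans (coefficient (Truncated.Π<-extend (suc n) F n<M
             (λ i n<i → agree λ j j≤n → p i j (ℕP.≤-trans (ℕP.≤-pred j≤n) (ℕP.<⇒≤ n<i)))) n ℕP.≤-refl)
           (≡.cong (λ f → f n) (≡.sym (prodUpTo≡Π< (suc n) (suc n) F)))))

i<1+a+mi : ∀ a m .{{_ : ℕ.NonZero m}} i → i ℕ.< suc a ℕ.+ m ℕ.* i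
i<1+a+mi a m i = ℕ.s≤s (ℕP.≤-trans (ℕP.m≤n*m i m) (ℕP.m≤n+m (m ℕ.* i) a))

sumℤ-∷ʳ : ∀ xs x → sumℤ (xs ∷ʳ x) ≡ sumℤ xs ℤ.+ x
sumℤ-∷ʳ []       x = ℤP.+-comm x (+ 0)
sumℤ-∷ʳ (y ∷ xs) x = ≡.trans (≡.cong (ℤ._+_ y) (sumℤ-∷ʳ xs x)) (≡.sym (ℤP.+-assoc y (sumℤ xs) x))

-- Return to the coefficients

module Coefficients (M : ℕ) where
  open Truncated M
  open Instance M

  qPoch≈O : ∀ a m {{_ : ℕ.NonZero m}} → qPoch (suc a) m ≈ O (suc a) m
  qPoch≈O a m = agree λ n n<M → ≡.trans
    (prodUpTo-stable F (λ i j j≤i → oneMinusQ-small (ℕP.≤-<-trans j≤i (i<1+a+mi a m i))) n<M)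
    (≡.trans (≡.cong (λ f → f n) (prodUpTo≡Π< M M F)) (coefficient (Π<-cong M (λ i → oneMinusQ≈ (a ℕ.+ m ℕ.* i))) n n<M))
    where
    F : ℕ → PS
    F i = oneMinusQ (suc a ℕ.+ m ℕ.* i)

  qPochInv≈O⁻¹ : ∀ a m {{_ : ℕ.NonZero m}} → qPochInv (suc a) m ≈ O⁻¹ (suc a) m
  qPochInv≈O⁻¹ a m = agree λ n n<M → ≡.trans
    (prodUpTo-stable F (λ i j j≤i → geomQ-small (ℕP.≤-<-trans j≤i (i<1+a+mi a m i))) n<M)
    (≡.cong (λ f → f n) (prodUpTo≡Π< M M F))
    where
    F : ℕ → PS
    F i = geomQ (suc a ℕ.+ m ℕ.* i)

  Σ<-coefficient : ∀ m F n → Σ< m F n ≡ sumℤ (applyUpTo (λ i → F i n) m)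
  Σ<-coefficient zero    F n = ≡.refl
  Σ<-coefficient (suc m) F n = begin
    Σ< m F n ℤ.+ F m n                              ≡⟨ ≡.cong (ℤ._+ F m n) (Σ<-coefficient m F n) ⟩
    sumℤ (applyUpTo (λ i → F i n) m) ℤ.+ F m n      ≡⟨ sumℤ-∷ʳ (applyUpTo (λ i → F i n) m) (F m n) ⟨
    sumℤ (applyUpTo (λ i → F i n) m ∷ʳ F m n)       ≡⟨ ≡.cong sumℤ (applyUpTo-∷ʳ (λ i → F i n) m) ⟩
    sumℤ (applyUpTo (λ i → F i n) (suc m))          ∎
    where open ≡.≡-Reasoning

  ψ-sum-coefficient : ∀ n → n ℕ.< M → (ψ 1 + δ 1 * ψ 5) n ≡
    sumℤ (map (λ i → δ (i ℕ.* suc i) n ℤ.+ δ (5 ℕ.* (i ℕ.* suc i) ℕ.+ 1) n) (upTo M))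
  ψ-sum-coefficient n n<M = begin
    (ψ 1 + δ 1 * ψ 5) n
      ≡⟨ coefficient ψ-sum n n<M ⟩
    Σ< M F n
      ≡⟨ coefficient (Σ<-cong M {F} {G} (λ i → agree λ j _ → ≡.cong₂ ℤ._+_
           (≡.trans (q^≡δ (1 ℕ.* (i ℕ.* suc i)) j) (≡.cong (λ k → δ k j) (ℕP.*-identityˡ (i ℕ.* suc i))))
           (≡.trans (q^≡δ (suc (5 ℕ.* (i ℕ.* suc i))) j) (≡.cong (λ k → δ k j) (ℕP.+-comm 1 (5 ℕ.* (i ℕ.* suc i)))))))
           n n<M ⟩
    Σ< M G n
      ≡⟨ Σ<-coefficient M G n ⟩
    sumℤ (applyUpTo (λ i → G i n) M)
      ≡⟨ ≡.cong sumℤ (map-upTo (λ i → G i n) M) ⟨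
    sumℤ (map (λ i → G i n) (upTo M)) ∎
    where
    open ≡.≡-Reasoning
    F G : ℕ → PS
    F i = δ 1 ^ (1 ℕ.* (i ℕ.* suc i)) + δ 1 ^ suc (5 ℕ.* (i ℕ.* suc i))
    G i n = δ (i ℕ.* suc i) n ℤ.+ δ (5 ℕ.* (i ℕ.* suc i) ℕ.+ 1) n

theorem17 : (N : ℕ) → lhsSeries N
    ≡ (qPoch 3 10 ⊛ qPoch 7 10 ⊛ qPoch 10 10 ⊛ qPoch 4 20 ⊛ qPoch 16 20
    ⊛ qPochInv 1 5 ⊛ qPochInv 4 5) N
-- For M = N + 1 the summation range of `lhsSeries N` is exactly that of `ψ`, and N is the highest
-- degree that survives modulo q^M.
theorem17 N = ≡.trans (≡.sym (ψ-sum-coefficient N ℕP.≤-refl))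
  (coefficient (trans ψ-sum-product (sym (*-cong (*-cong (*-cong (*-cong (*-cong (*-cong
    (qPoch≈O 2 10) (qPoch≈O 6 10)) (qPoch≈O 9 10)) (qPoch≈O 3 20)) (qPoch≈O 15 20))
    (qPochInv≈O⁻¹ 0 5)) (qPochInv≈O⁻¹ 3 5)))) N ℕP.≤-refl)
  where
  open Truncated (suc N)
  open Instance (suc N)
  open Coefficients (suc N)
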